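{- Let $G$ be a graph on $n$ vertices and let $w\in\mathbb{R}^n_+$ be a vector with nonnegative entries, indexed by $V(G)$. For a cone $\mathcal{K}$ of real symmetric $n\times n$ matrices consider the program $$\max\ \big\langle \sqrt{w}\sqrt{w}^{\,T},Z\big\rangle\quad\text{subject to}\quad \big\langle (I+\overline{A})_w,Z\big\rangle=1,\quad Z\in\mathcal{K}.$$ If $\mathcal{K}$ is the doubly nonnegative cone, this program is equal to $\chi_{\mathrm{vec}}(G;w)$; and if $\mathcal{K}=\mathcal{CP}_n$, this program is equal to $\omega(G;w)$.
   Context: Graphs are finite and simple. $I$ is the identity matrix and $\overline{A}$ is the adjacency matrix of the complement of $G$; $\langle M,N\rangle=\mathrm{tr}(MN)$ for real symmetric matrices; $\circ$ is the entrywise product; $\sqrt{w}$ is the entrywise square root of $w$. A real symmetric matrix is doubly nonnegative if it is positive semidefinite and entrywise nonnegative. $\mathcal{CP}_n=\{\sum_{i=1}^k x_ix_i^T: x_i\in\mathbb{R}^n,\ x_i\ge 0\}$ is the cone of completely positive matrices. $D(u)$ is the diagonal matrix with diagonal $u$, $D(u)^+$ is its pseudo-inverse, and for symmetric $M$, $$M_w=\tfrac12\Big(D(\sqrt w)\,M\,D(\sqrt w)^{+}+D(\sqrt w)^{+}\,M\,D(\sqrt w)\Big).$$ The vertex-weighted parameters $\chi_{\mathrm{vec}}(G;w)$ (weighted vector chromatic number) and $\omega(G;w)$ (weighted clique number) are given by the program: maximize $\langle \sqrt{w}\sqrt{w}^{\,T},Z\rangle$ subject to $\langle I,Z\rangle=1$,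 $Z\circ\overline{A}=0$, $Z\in\mathcal{K}$. Its value is $\chi_{\mathrm{vec}}(G;w)$ when $\mathcal{K}$ is the doubly nonnegative cone, and $\omega(G;w)$ when $\mathcal{K}=\mathcal{CP}_n$. -}

module Defs where

open import Algebra.Bundles using (CommutativeRing)
open import Data.Bool.Base using (if_then_else_)
open import Data.Fin.Base using (Fin; zero; suc)
import Data.Fin.Properties as Fin
open import Data.Nat.Base using (ℕ; suc)
open import Data.Product using (∃; ∃-syntax; Σ-syntax; _×_; _,_; proj₁; proj₂)
open import Data.Sum using (_⊎_; inj₁; inj₂)
open import Data.Vec.Functional using (Vector)
open import Function.Base using (_∘_)
open import Level using (0ℓ)
open import Relation.Binary.Core using (Rel)
open import Relation.Binary.Definitions using (Decidable; Irreflexive; Symmetric)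
open import Relation.Binary.PropositionalEquality as ≡ using (_≡_; _≢_)
open import Relation.Binary.Structures using (IsDecTotalOrder)
open import Relation.Nullary using (does; yes; no; ¬_; ¬?; contradiction)
open import Relation.Nullary.Decidable using (_×-dec_)

-- A Dedekind-complete ordered field with decidable order: classically, ℝ up
-- to unique isomorphism.  Under excluded middle the Dedekind cuts of ℚ give
-- a model.

record CompleteOrderedField : Set₁ where
  field
    commutativeRing : CommutativeRing 0ℓ 0ℓ

  open CommutativeRing commutativeRing public hiding (zero)

  infix 4 _≤_

  field
    _≤_             : Rel Carrier 0ℓ
    isDecTotalOrder : IsDecTotalOrder _≈_ _≤_
    +-monoˡ-≤       : ∀ {x y} z → x ≤ y → x + z ≤ y + z
    *-nonneg        : ∀ {x y} → 0# ≤ x → 0# ≤ y → 0# ≤ x * y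
    1≉0             : ¬ 1# ≈ 0#
    invertible      : ∀ x → ¬ x ≈ 0# → ∃[ y ] x * y ≈ 1#

  _IsUpperBoundOf_ : Carrier → (Carrier → Set) → Set
  b IsUpperBoundOf P = ∀ x → P x → x ≤ b

  _IsSupremumOf_ : Carrier → (Carrier → Set) → Set
  s IsSupremumOf P = s IsUpperBoundOf P × (∀ b → b IsUpperBoundOf P → s ≤ b)

  field
    complete : (P : Carrier → Set) → ∃ P → ∃ (_IsUpperBoundOf P) →
               ∃ (_IsSupremumOf P)

module OrderedFieldProperties (ℝ : CompleteOrderedField) where

  open CompleteOrderedField ℝ
  open IsDecTotalOrder isDecTotalOrder public
    using (_≟_; _≤?_; total; antisym; ≤-respˡ-≈; ≤-respʳ-≈)
    renaming (refl to ≤-refl; trans to ≤-trans; reflexive to ≤-reflexive)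

  private
    module ≈ = CommutativeRing commutativeRing

  open import Algebra.Properties.Ring ≈.ring using (-‿distribˡ-*; -‿distribʳ-*; -‿involutive)
  open import Algebra.Solver.Ring.NaturalCoefficients.Default ≈.commutativeSemiring
  open import Relation.Binary.Reasoning.Setoid ≈.setoid

  +-cancelʳ-≤ : ∀ {x y} z → x + z ≤ y + z → x ≤ y
  +-cancelʳ-≤ z p = ≤-respˡ-≈ (undo _) (≤-respʳ-≈ (undo _) (+-monoˡ-≤ (- z) p))
    where
    undo : ∀ x → (x + z) + - z ≈ x
    undo x = trans (+-assoc x z (- z)) (trans (+-congˡ (-‿inverseʳ z)) (+-identityʳ x))

  ≤⇒∃ : ∀ {x y} → x ≤ y → ∃[ d ] 0# ≤ d × x + d ≈ y
  ≤⇒∃ {x} {y} x≤y = y + - x , ≤-respˡ-≈ (-‿inverseʳ x) (+-monoˡ-≤ (- x) x≤y) , (begin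
    x + (y + - x)  ≈⟨ +-comm x _ ⟩
    (y + - x) + x  ≈⟨ +-assoc y (- x) x ⟩
    y + (- x + x)  ≈⟨ +-congˡ (-‿inverseˡ x) ⟩
    y + 0#         ≈⟨ +-identityʳ y ⟩
    y              ∎)

  ∃⇒≤ : ∀ {x y} d → 0# ≤ d → x + d ≈ y → x ≤ y
  ∃⇒≤ {x} d 0≤d x+d≈y =
    ≤-respˡ-≈ (+-identityˡ x) (≤-respʳ-≈ (trans (+-comm d x) x+d≈y) (+-monoˡ-≤ x 0≤d))

  +-nonneg : ∀ {x y} → 0# ≤ x → 0# ≤ y → 0# ≤ x + y
  +-nonneg {x} {y} 0≤x 0≤y = ≤-trans 0≤x (∃⇒≤ y 0≤y refl)

  *-monoʳ-≤ : ∀ {x y} z → 0# ≤ z → x ≤ y → x * z ≤ y * z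
  *-monoʳ-≤ {x} {y} z 0≤z x≤y with d , 0≤d , x+d≈y ← ≤⇒∃ x≤y =
    ∃⇒≤ (d * z) (*-nonneg 0≤d 0≤z) (trans (sym (distribʳ z x d)) (*-congʳ x+d≈y))

  square-nonneg : ∀ x → 0# ≤ x * x
  square-nonneg x with total 0# x
  ... | inj₁ 0≤x = *-nonneg 0≤x 0≤x
  ... | inj₂ x≤0 = ≤-respʳ-≈ -x*-x≈x*x (*-nonneg 0≤-x 0≤-x)
    where
    0≤-x : 0# ≤ - x
    0≤-x = ≤-respˡ-≈ (-‿inverseʳ x) (≤-respʳ-≈ (+-identityˡ (- x)) (+-monoˡ-≤ (- x) x≤0))
    -x*-x≈x*x : - x * - x ≈ x * x
    -x*-x≈x*x = begin
      - x * - x      ≈⟨ -‿distribˡ-* x (- x) ⟨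
      - (x * - x)    ≈⟨ -‿cong (-‿distribʳ-* x x) ⟨
      - (- (x * x))  ≈⟨ -‿involutive (x * x) ⟩
      x * x          ∎

  0≤1 : 0# ≤ 1#
  0≤1 = ≤-respʳ-≈ (*-identityˡ 1#) (square-nonneg 1#)

  -- The reciprocal, extended by 0⁻¹ = 0.
  infix 8 _⁻¹
  _⁻¹ : Carrier → Carrier
  x ⁻¹ with x ≟ 0#
  ... | yes _  = 0#
  ... | no x≉0 = proj₁ (invertible x x≉0)

  ⁻¹-inverseʳ : ∀ x → ¬ x ≈ 0# → x * x ⁻¹ ≈ 1#
  ⁻¹-inverseʳ x x≉0 with x ≟ 0#
  ... | yes x≈0 = contradiction x≈0 x≉0
  ... | no x≉0′ = proj₂ (invertible x x≉0′)

  x*x⁻¹*x≈x : ∀ x → (x * x ⁻¹) * x ≈ x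
  x*x⁻¹*x≈x x with x ≟ 0#
  ... | yes x≈0 = trans (*-congʳ (zeroʳ x)) (trans (zeroˡ x) (sym x≈0))
  ... | no x≉0  = trans (*-congʳ (proj₂ (invertible x x≉0))) (*-identityˡ x)

  x⁻¹*x*x⁻¹≈x⁻¹ : ∀ x → (x ⁻¹ * x) * x ⁻¹ ≈ x ⁻¹
  x⁻¹*x*x⁻¹≈x⁻¹ x with x ≟ 0#
  ... | yes _  = zeroʳ (0# * x)
  ... | no x≉0 = trans (*-congʳ (trans (*-comm _ x) (proj₂ (invertible x x≉0)))) (*-identityˡ _)

  ⁻¹-nonneg : ∀ x → 0# ≤ x → ¬ x ≈ 0# → 0# ≤ x ⁻¹
  ⁻¹-nonneg x 0≤x x≉0 = ≤-respʳ-≈ eq (*-nonneg 0≤x (square-nonneg (x ⁻¹)))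
    where
    eq : x * (x ⁻¹ * x ⁻¹) ≈ x ⁻¹
    eq = trans (sym (*-assoc x _ _)) (trans (*-congʳ (⁻¹-inverseʳ x x≉0)) (*-identityˡ _))

  0≤x⇒x+1≉0 : ∀ {x} → 0# ≤ x → ¬ x + 1# ≈ 0#
  0≤x⇒x+1≉0 {x} 0≤x x+1≈0 =
    1≉0 (antisym (≤-respʳ-≈ x+1≈0 (∃⇒≤ x 0≤x (+-comm 1# x))) 0≤1)

  ½ : Carrier
  ½ = (1# + 1#) ⁻¹

  SquareAtMost : Carrier → Carrier → Set
  SquareAtMost x y = 0# ≤ y × y * y ≤ x

  sup-SquareAtMost : ∀ x → 0# ≤ x → ∃ (_IsSupremumOf (SquareAtMost x))
  sup-SquareAtMost x 0≤x = complete (SquareAtMost x)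
    (0# , ≤-refl , ≤-respˡ-≈ (sym (zeroˡ 0#)) 0≤x)
    (x + 1# , bound)
    where
    bound : (x + 1#) IsUpperBoundOf SquareAtMost x
    bound y (0≤y , y²≤x) with total y 1#
    ... | inj₁ y≤1 = ≤-trans y≤1 (∃⇒≤ x 0≤x (+-comm 1# x))
    ... | inj₂ 1≤y = ≤-trans (≤-respˡ-≈ (*-identityˡ y) (*-monoʳ-≤ y 0≤y 1≤y))
                             (≤-trans y²≤x (∃⇒≤ 1# 0≤1 refl))

  -- The nonnegative square root, with the junk value 0 at negative arguments.
  √_ : Carrier → Carrier
  √ x with 0# ≤? x
  ... | yes 0≤x = proj₁ (sup-SquareAtMost x 0≤x)
  ... | no  _   = 0#

  private
    module Root (x : Carrier) (0≤x : 0# ≤ x) where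

      s : Carrier
      s = proj₁ (sup-SquareAtMost x 0≤x)

      ub : s IsUpperBoundOf SquareAtMost x
      ub = proj₁ (proj₂ (sup-SquareAtMost x 0≤x))

      0≤s : 0# ≤ s
      0≤s = ub 0# (≤-refl , ≤-respˡ-≈ (sym (zeroˡ 0#)) 0≤x)

      double-product : ∀ a b → (a * b) + (a * b) ≤ a * a + b * b
      double-product a b with total a b
      ... | inj₁ a≤b with d , _ , a+d≈b ← ≤⇒∃ a≤b =
        ∃⇒≤ (d * d) (square-nonneg d) (begin
          (a * b + a * b) + d * d
            ≈⟨ +-congʳ (+-cong (*-congˡ a+d≈b) (*-congˡ a+d≈b)) ⟨
          (a * (a + d) + a * (a + d)) + d * d
            ≈⟨ solve 2 (λ a d → (a :* (a :+ d) :+ a :* (a :+ d)) :+ d :* d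
                              := a :* a :+ (a :+ d) :* (a :+ d)) refl a d ⟩
          a * a + (a + d) * (a + d)
            ≈⟨ +-congˡ (*-cong a+d≈b a+d≈b) ⟩
          a * a + b * b ∎)
      ... | inj₂ b≤a with d , _ , b+d≈a ← ≤⇒∃ b≤a =
        ∃⇒≤ (d * d) (square-nonneg d) (begin
          (a * b + a * b) + d * d
            ≈⟨ +-congʳ (+-cong (*-congʳ b+d≈a) (*-congʳ b+d≈a)) ⟨
          ((b + d) * b + (b + d) * b) + d * d
            ≈⟨ solve 2 (λ b d → ((b :+ d) :* b :+ (b :+ d) :* b) :+ d :* d
                              := (b :+ d) :* (b :+ d) :+ b :* b) refl b d ⟩
          (b + d) * (b + d) + b * b
            ≈⟨ +-congʳ (*-cong b+d≈a b+d≈a) ⟩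
          a * a + b * b ∎)

      -- If s ≠ 0, the Newton step (s² + x) / 2s is again an upper bound.
      s²≤x : s * s ≤ x
      s²≤x with s ≟ 0#
      ... | yes s≈0 = ≤-respˡ-≈ (sym (trans (*-congʳ s≈0) (zeroˡ s))) 0≤x
      ... | no  s≉0 = +-cancelʳ-≤ (s * s)
        (≤-respˡ-≈ (solve 1 (λ s → s :* (s :+ s) := s :* s :+ s :* s) refl s)
        (≤-respʳ-≈ t*2s≈
          (*-monoʳ-≤ (s + s) 0≤2s (proj₂ (proj₂ (sup-SquareAtMost x 0≤x)) t t-bound))))
        where
        0≤2s : 0# ≤ s + s
        0≤2s = +-nonneg 0≤s 0≤s
        2s≉0 : ¬ s + s ≈ 0#
        2s≉0 e = s≉0 (antisym (≤-respʳ-≈ e (∃⇒≤ s 0≤s refl)) 0≤s)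
        i = (s + s) ⁻¹
        0≤i : 0# ≤ i
        0≤i = ⁻¹-nonneg (s + s) 0≤2s 2s≉0
        2s*i≈1 : (s + s) * i ≈ 1#
        2s*i≈1 = ⁻¹-inverseʳ (s + s) 2s≉0
        t = (x + s * s) * i
        t*2s≈ : t * (s + s) ≈ x + s * s
        t*2s≈ = trans (*-assoc _ i (s + s))
                (trans (*-congˡ (trans (*-comm i _) 2s*i≈1)) (*-identityʳ _))
        t-bound : t IsUpperBoundOf SquareAtMost x
        t-bound y (0≤y , y²≤x) = ≤-respˡ-≈
          (begin
            (s * y + s * y) * i  ≈⟨ solve 3 (λ s y i → (s :* y :+ s :* y) :* i
                                                   := y :* ((s :+ s) :* i)) refl s y i ⟩
            y * ((s + s) * i)    ≈⟨ *-congˡ 2s*i≈1 ⟩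
            y * 1#               ≈⟨ *-identityʳ y ⟩
            y                    ∎)
          (*-monoʳ-≤ i 0≤i (≤-trans (double-product s y)
            (≤-respˡ-≈ (+-comm (y * y) (s * s)) (+-monoˡ-≤ (s * s) y²≤x))))

      -- With c = x + 1 ≥ √x, the number (sc + x) / (s + c) has square at most x.
      x≤s² : x ≤ s * s
      x≤s² = +-cancelʳ-≤ (s * c)
        (≤-respˡ-≈ (trans y*e≈ (+-comm (s * c) x)) (≤-respʳ-≈ (distribˡ s s c)
          (*-monoʳ-≤ (s + c) 0≤s+c (ub y (*-nonneg 0≤num 0≤j , y²≤x)))))
        where
        c = x + 1#
        0≤c : 0# ≤ c
        0≤c = +-nonneg 0≤x 0≤1
        0≤s+c : 0# ≤ s + c
        0≤s+c = +-nonneg 0≤s 0≤c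
        s+c≉0 : ¬ s + c ≈ 0#
        s+c≉0 e = 0≤x⇒x+1≉0 (+-nonneg 0≤s 0≤x) (trans (+-assoc s x 1#) e)
        j = (s + c) ⁻¹
        0≤j : 0# ≤ j
        0≤j = ⁻¹-nonneg (s + c) 0≤s+c s+c≉0
        e*j≈1 : (s + c) * j ≈ 1#
        e*j≈1 = ⁻¹-inverseʳ (s + c) s+c≉0
        num = s * c + x
        0≤num : 0# ≤ num
        0≤num = +-nonneg (*-nonneg 0≤s 0≤c) 0≤x
        y = num * j
        y*e≈ : y * (s + c) ≈ num
        y*e≈ = trans (*-assoc _ j (s + c))
               (trans (*-congˡ (trans (*-comm j _) e*j≈1)) (*-identityʳ _))
        num²≤ : num * num ≤ x * ((s + c) * (s + c))
        num²≤ with d , 0≤d , s²+d≈x ← ≤⇒∃ s²≤x =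
          ∃⇒≤ (d * (x * x + x + 1#))
            (*-nonneg 0≤d (+-nonneg (+-nonneg (square-nonneg x) 0≤x) 0≤1)) (begin
            num * num + d * (x * x + x + 1#)
              ≈⟨ solve 3 (λ s d x →
                   (s :* (x :+ con 1) :+ x) :* (s :* (x :+ con 1) :+ x)
                     :+ d :* (x :* x :+ x :+ con 1)
                   := (s :* s :+ d) :* (x :* x :+ x :+ con 1) :+ s :* s :* x
                     :+ (s :* x :* (x :+ con 1) :+ s :* x :* (x :+ con 1)) :+ x :* x)
                 refl s d x ⟩
            (s * s + d) * (x * x + x + 1#) + s * s * x
              + (s * x * (x + 1#) + s * x * (x + 1#)) + x * x
              ≈⟨ +-congʳ (+-congʳ (+-congʳ (*-congʳ s²+d≈x))) ⟩
            x * (x * x + x + 1#) + s * s * x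
              + (s * x * (x + 1#) + s * x * (x + 1#)) + x * x
              ≈⟨ solve 2 (λ s x →
                   x :* (x :* x :+ x :+ con 1) :+ s :* s :* x
                     :+ (s :* x :* (x :+ con 1) :+ s :* x :* (x :+ con 1)) :+ x :* x
                   := x :* ((s :+ (x :+ con 1)) :* (s :+ (x :+ con 1))))
                 refl s x ⟩
            x * ((s + c) * (s + c)) ∎)
        y²≤x : y * y ≤ x
        y²≤x = ≤-respˡ-≈
          (solve 2 (λ a j → a :* a :* (j :* j) := (a :* j) :* (a :* j)) refl num j)
          (≤-respʳ-≈ (begin
            x * ((s + c) * (s + c)) * (j * j)
              ≈⟨ solve 3 (λ x e j → x :* (e :* e) :* (j :* j)
                                  := x :* ((e :* j) :* (e :* j))) refl x (s + c) j ⟩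
            x * (((s + c) * j) * ((s + c) * j))  ≈⟨ *-congˡ (*-cong e*j≈1 e*j≈1) ⟩
            x * (1# * 1#)                        ≈⟨ *-congˡ (*-identityˡ 1#) ⟩
            x * 1#                               ≈⟨ *-identityʳ x ⟩
            x                                    ∎)
          (*-monoʳ-≤ (j * j) (square-nonneg j) num²≤))

  √-nonneg : ∀ x → 0# ≤ √ x
  √-nonneg x with 0# ≤? x
  ... | yes 0≤x = Root.0≤s x 0≤x
  ... | no  _   = ≤-refl

  √-square : ∀ x → 0# ≤ x → √ x * √ x ≈ x
  √-square x 0≤x with 0# ≤? x
  ... | yes p   = antisym (Root.s²≤x x p) (Root.x≤s² x p)
  ... | no  0≰x = contradiction 0≤x 0≰x

record Graph (n : ℕ) : Set₁ where
  field
    Adjacent  : Rel (Fin n) 0ℓ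
    adjacent? : Decidable Adjacent
    symmetric : Symmetric Adjacent
    loopless  : Irreflexive _≡_ Adjacent

complement : ∀ {n} → Graph n → Graph n
complement G = record
  { Adjacent  = λ i j → i ≢ j × ¬ Adjacent i j
  ; adjacent? = λ i j → ¬? (i Fin.≟ j) ×-dec ¬? (adjacent? i j)
  ; symmetric = λ (i≢j , ¬ij) → i≢j ∘ ≡.sym , ¬ij ∘ symmetric
  ; loopless  = λ i≡j (i≢j , _) → i≢j i≡j
  }
  where open Graph G

module ConicPrograms (ℝ : CompleteOrderedField) where

  open CompleteOrderedField ℝ
  open OrderedFieldProperties ℝ using (√_; _⁻¹; ½; x*x⁻¹*x≈x; x⁻¹*x*x⁻¹≈x⁻¹)

  open import Algebra.Properties.Semiring.Sum semiring using (sum; sum-syntax; sum-cong-≋; sum-replicate-zero)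

  Matrix : ℕ → Set
  Matrix n = Vector (Vector Carrier n) n

  infix  4 _≈ᴹ_
  infixl 6 _⊕_
  infixl 7 _⊗_ _⊙_ _·_

  _≈ᴹ_ : ∀ {n} → Rel (Matrix n) 0ℓ
  A ≈ᴹ B = ∀ i j → A i j ≈ B i j

  𝟎 : ∀ {n} → Matrix n
  𝟎 i j = 0#

  diagonal : ∀ {n} → Vector Carrier n → Matrix n
  diagonal u i j = if does (i Fin.≟ j) then u i else 0#

  𝐈 : ∀ {n} → Matrix n
  𝐈 = diagonal (λ _ → 1#)

  transpose : ∀ {n} → Matrix n → Matrix n
  transpose A i j = A j i

  _⊕_ _⊗_ _⊙_ : ∀ {n} → Matrix n → Matrix n → Matrix n
  (A ⊕ B) i j = A i j + B i j
  _⊗_ {n} A B i j = ∑[ k < n ] (A i k * B k j)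
  (A ⊙ B) i j = A i j * B i j

  _·_ : ∀ {n} → Carrier → Matrix n → Matrix n
  (c · A) i j = c * A i j

  outer : ∀ {n} → Vector Carrier n → Matrix n
  outer x i j = x i * x j

  trace : ∀ {n} → Matrix n → Carrier
  trace {n} A = ∑[ i < n ] A i i

  ⟨_,_⟩ : ∀ {n} → Matrix n → Matrix n → Carrier
  ⟨ A , B ⟩ = trace (A ⊗ B)

  adjacency : ∀ {n} → Graph n → Matrix n
  adjacency G i j = if does (Graph.adjacent? G i j) then 1# else 0#

  NonNegative : ∀ {n} → Vector Carrier n → Set
  NonNegative x = ∀ i → 0# ≤ x i

  IsSymmetric : ∀ {n} → Matrix n → Set
  IsSymmetric A = transpose A ≈ᴹ A

  PositiveSemidefinite : ∀ {n} → Matrix n → Set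
  PositiveSemidefinite {n} A =
    IsSymmetric A × (∀ (x : Vector Carrier n) → 0# ≤ ∑[ i < n ] ∑[ j < n ] (x i * A i j * x j))

  DoublyNonnegative : ∀ {n} → Matrix n → Set
  DoublyNonnegative A = PositiveSemidefinite A × (∀ i j → 0# ≤ A i j)

  CompletelyPositive : ∀ {n} → Matrix n → Set
  CompletelyPositive {n} A = ∃[ k ] Σ[ x ∈ Vector (Vector Carrier n) k ]
    (∀ l → NonNegative (x l)) × A ≈ᴹ (λ i j → ∑[ l < k ] outer (x l) i j)

  IsPseudoInverse : ∀ {n} → Matrix n → Matrix n → Set
  IsPseudoInverse A X =
    (A ⊗ X) ⊗ A ≈ᴹ A × (X ⊗ A) ⊗ X ≈ᴹ X × IsSymmetric (A ⊗ X) × IsSymmetric (X ⊗ A)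

  diagonal⁺ : ∀ {n} → Vector Carrier n → Matrix n
  diagonal⁺ u = diagonal (λ i → u i ⁻¹)

  private
    sum-single : ∀ {n} (f : Vector Carrier n) i → (∀ k → i ≢ k → f k ≈ 0#) → sum f ≈ f i
    sum-single {suc n} f zero f≈0 =
      trans (+-congˡ (trans (sum-cong-≋ (λ k → f≈0 (suc k) λ ())) (sum-replicate-zero n)))
            (+-identityʳ _)
    sum-single f (suc i) f≈0 =
      trans (+-cong (f≈0 zero λ ()) (sum-single (f ∘ suc) i λ k i≢k → f≈0 (suc k) (i≢k ∘ Fin.suc-injective)))
            (+-identityˡ _)

    diagonal-≡ : ∀ {n} (u : Vector Carrier n) i → diagonal u i i ≈ u i
    diagonal-≡ u i with i Fin.≟ i
    ... | yes _  = refl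
    ... | no i≢i = contradiction ≡.refl i≢i

    diagonal-≢ : ∀ {n} (u : Vector Carrier n) {i j} → i ≢ j → diagonal u i j ≈ 0#
    diagonal-≢ u {i} {j} i≢j with i Fin.≟ j
    ... | yes i≡j = contradiction i≡j i≢j
    ... | no _    = refl

    diagonal-⊗ˡ : ∀ {n} (u : Vector Carrier n) A i j → (diagonal u ⊗ A) i j ≈ u i * A i j
    diagonal-⊗ˡ u A i j = trans
      (sum-single (λ k → diagonal u i k * A k j) i
        (λ k i≢k → trans (*-congʳ (diagonal-≢ u i≢k)) (zeroˡ _)))
      (*-congʳ (diagonal-≡ u i))

    diagonal-⊗ : ∀ {n} (u v : Vector Carrier n) →
                 diagonal u ⊗ diagonal v ≈ᴹ diagonal (λ i → u i * v i)
    diagonal-⊗ u v i j = trans (diagonal-⊗ˡ u (diagonal v) i j) (entry i j)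
      where
      entry : ∀ i j → u i * diagonal v i j ≈ diagonal (λ i → u i * v i) i j
      entry i j with i Fin.≟ j
      ... | yes _ = refl
      ... | no _  = zeroʳ (u i)

    diagonal-cong : ∀ {n} {u v : Vector Carrier n} → (∀ i → u i ≈ v i) → diagonal u ≈ᴹ diagonal v
    diagonal-cong u≈v i j with i Fin.≟ j
    ... | yes _ = u≈v i
    ... | no _  = refl

    diagonal-symmetric : ∀ {n} (u : Vector Carrier n) → IsSymmetric (diagonal u)
    diagonal-symmetric u i j with i Fin.≟ j
    ... | yes ≡.refl = diagonal-≡ u i
    ... | no i≢j     = diagonal-≢ u (i≢j ∘ ≡.sym)

    diagonal-⊗-symmetric : ∀ {n} (u v : Vector Carrier n) → IsSymmetric (diagonal u ⊗ diagonal v)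
    diagonal-⊗-symmetric u v i j =
      trans (diagonal-⊗ u v j i) (trans (diagonal-symmetric (λ k → u k * v k) i j) (sym (diagonal-⊗ u v i j)))

    diagonal-⊗-⊗ : ∀ {n} (u v w : Vector Carrier n) →
      (diagonal u ⊗ diagonal v) ⊗ diagonal w ≈ᴹ diagonal (λ i → (u i * v i) * w i)
    diagonal-⊗-⊗ u v w i j =
      trans (sum-cong-≋ (λ k → *-congʳ (diagonal-⊗ u v i k))) (diagonal-⊗ (λ k → u k * v k) w i j)

  diagonal⁺-isPseudoInverse : ∀ {n} (u : Vector Carrier n) → IsPseudoInverse (diagonal u) (diagonal⁺ u)
  diagonal⁺-isPseudoInverse u =
    (λ i j → trans (diagonal-⊗-⊗ u u⁺ u i j) (diagonal-cong (x*x⁻¹*x≈x ∘ u) i j)) ,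
    (λ i j → trans (diagonal-⊗-⊗ u⁺ u u⁺ i j) (diagonal-cong (x⁻¹*x*x⁻¹≈x⁻¹ ∘ u) i j)) ,
    diagonal-⊗-symmetric u u⁺ ,
    diagonal-⊗-symmetric u⁺ u
    where
    u⁺ = λ i → u i ⁻¹

  √ᵛ : ∀ {n} → Vector Carrier n → Vector Carrier n
  √ᵛ w i = √ (w i)

  weighted : ∀ {n} → Vector Carrier n → Matrix n → Matrix n
  weighted w M = ½ · (D ⊗ M ⊗ D⁺ ⊕ D⁺ ⊗ M ⊗ D)
    where
    D  = diagonal (√ᵛ w)
    D⁺ = diagonal⁺ (√ᵛ w)

  record Maximization (X : Set) : Set₁ where
    field
      objective : X → Carrier
      Feasible  : X → Set

  _IsMaximumOf_ : ∀ {X} → Carrier → Maximization X → Set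
  v IsMaximumOf P =
    (∃[ x ] Feasible x × objective x ≈ v) × (∀ x → Feasible x → objective x ≤ v)
    where open Maximization P

  -- An infeasible program is given the value 0, the supremum of the empty set
  -- in [0,∞): all objectives below are nonnegative on the feasible set.  This
  -- matters only when w = 0, where `weightedProgram` is infeasible because
  -- `weighted w M` vanishes.
  _IsValueOf_ : ∀ {X} → Carrier → Maximization X → Set
  v IsValueOf P = v IsMaximumOf P ⊎ (¬ ∃ Feasible × v ≈ 0#)
    where open Maximization P

  module _ {n} (𝒦 : Matrix n → Set) (G : Graph n) (w : Vector Carrier n) where

    definingProgram : Maximization (Matrix n)
    definingProgram = record
      { objective = λ Z → ⟨ outer (√ᵛ w) , Z ⟩
      ; Feasible  = λ Z → ⟨ 𝐈 , Z ⟩ ≈ 1# × Z ⊙ adjacency (complement G) ≈ᴹ 𝟎 × 𝒦 Z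
      }

    weightedProgram : Maximization (Matrix n)
    weightedProgram = record
      { objective = λ Z → ⟨ outer (√ᵛ w) , Z ⟩
      ; Feasible  = λ Z → ⟨ weighted w (𝐈 ⊕ adjacency (complement G)) , Z ⟩ ≈ 1# × 𝒦 Z
      }

  IsWeightedVectorChromaticNumber : ∀ {n} → Graph n → Vector Carrier n → Carrier → Set
  IsWeightedVectorChromaticNumber G w v = v IsValueOf definingProgram DoublyNonnegative G w

  IsWeightedCliqueNumber : ∀ {n} → Graph n → Vector Carrier n → Carrier → Set
  IsWeightedCliqueNumber G w v = v IsValueOf definingProgram CompletelyPositive G w

module Submission where

-- Put s = √w, M = (I + Ā)_w.  A Z in the cone with Z ∘ Ā = 0 has
-- ⟨M , Z⟩ ≤ tr Z, so if v is attained by the first program and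
-- ⟨s sᵀ , Z⟩ ≤ v ⟨M , Z⟩ holds on the whole cone, then v is the maximum of
-- both programs.  In each case the inequality rests on the vectors
-- eᵢ / sᵢ − eⱼ / sⱼ with i, j nonadjacent: they are orthogonal to s and
-- isotropic for M.
--
-- For doubly nonnegative Z, adding Zᵢⱼ sᵢ sⱼ times the outer square of this
-- vector for all nonadjacent i < j kills the entries at non-edges, keeps
-- ⟨s sᵀ , Z⟩ and turns ⟨M , Z⟩ into the trace; the maximum of the first
-- program exists by compactness.  For completely positive Z it suffices to
-- take Z = x xᵀ.  Along this direction xᵀ M x is affine and sᵀ x constant, so
-- x can be moved until its support in {w > 0} is a clique, where
-- Cauchy–Schwarz bounds (sᵀ x)² by the weight of the clique times xᵀ M x; v is
-- the maximal weight of a clique.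

open import Defs
open import Axiom.ExcludedMiddle using (ExcludedMiddle)
open import Data.Bool.Base using (Bool; if_then_else_; not; true; false)
open import Data.Fin.Base using (Fin; zero; suc; combine; remQuot)
import Data.Fin.Properties as Fin
open import Data.List.Base using (List; []; _∷_; allFin; cartesianProduct)
open import Data.List.Membership.Propositional.Properties using (∈-allFin; ∈-cartesianProduct⁺)
open import Data.List.Relation.Unary.All as All using (All; []; _∷_)
open import Data.Nat.Base as ℕ using (ℕ)
open import Data.Product using (∃; ∃-syntax; Σ-syntax; _×_; _,_; proj₁; proj₂; uncurry)
open import Data.Sum using (_⊎_; inj₁; inj₂)
open import Data.Vec.Base using (Vec; []; _∷_; lookup; tabulate; replicate)
open import Data.Vec.Functional using (Vector)
open import Data.Vec.Properties using (lookup∘tabulate; lookup-replicate)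
open import Function.Base using (_∘_; case_of_)
open import Level using (0ℓ)
open import Relation.Binary.Bundles using (Poset)
open import Relation.Binary.PropositionalEquality as ≡ using (_≡_; _≢_)
open import Relation.Binary.Structures using (IsDecTotalOrder)
open import Relation.Nullary using (does; yes; no; ¬_; ¬?; contradiction)
open import Relation.Nullary.Decidable using (decidable-stable)

module OrderedSums (ℝ : CompleteOrderedField) where

  open CompleteOrderedField ℝ public
  open OrderedFieldProperties ℝ public
  open ConicPrograms ℝ public
  open import Algebra.Properties.Ring ring public using (-1*x≈-x)
  open import Algebra.Properties.Semiring.Sum semiring public
    using (sum; sum-syntax; sum-cong-≋; sum-replicate-zero; ∑-comm; ∑-distrib-+;
           *-distribˡ-sum; *-distribʳ-sum)
  open import Algebra.Solver.Ring.NaturalCoefficients.Default commutativeSemiring public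
    using (solve; con; _:+_; _:*_; _:=_)

  ≤-poset : Poset 0ℓ 0ℓ 0ℓ
  ≤-poset = record { isPartialOrder = IsDecTotalOrder.isPartialOrder isDecTotalOrder }

  open import Relation.Binary.Reasoning.PartialOrder ≤-poset public

  +-mono-≤ : ∀ {a b c d} → a ≤ b → c ≤ d → a + c ≤ b + d
  +-mono-≤ {a} {b} {c} {d} a≤b c≤d = begin
    a + c ≤⟨ +-monoˡ-≤ c a≤b ⟩
    b + c ≈⟨ +-comm b c ⟩
    c + b ≤⟨ +-monoˡ-≤ b c≤d ⟩
    d + b ≈⟨ +-comm d b ⟩
    b + d ∎

  *-monoˡ-≤ : ∀ {a b} c → 0# ≤ c → a ≤ b → c * a ≤ c * b
  *-monoˡ-≤ {a} {b} c 0≤c a≤b = begin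
    c * a ≈⟨ *-comm c a ⟩
    a * c ≤⟨ *-monoʳ-≤ c 0≤c a≤b ⟩
    b * c ≈⟨ *-comm b c ⟩
    c * b ∎

  x≤x+y : ∀ {x y} → 0# ≤ y → x ≤ x + y
  x≤x+y {y = y} 0≤y = ∃⇒≤ y 0≤y refl

  x≤y+x : ∀ {x y} → 0# ≤ y → x ≤ y + x
  x≤y+x {x} {y} 0≤y = ≤-respʳ-≈ (+-comm x y) (x≤x+y 0≤y)

  double-cancel-≤ : ∀ {x y} → x + x ≤ y + y → x ≤ y
  double-cancel-≤ {x} {y} 2x≤2y with total x y
  ... | inj₁ x≤y = x≤y
  ... | inj₂ y≤x = +-cancelʳ-≤ x (≤-trans 2x≤2y (+-mono-≤ ≤-refl y≤x))

  -1# : Carrier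
  -1# = - 1#

  x+-1*x≈0 : ∀ x → x + -1# * x ≈ 0#
  x+-1*x≈0 x = trans (+-congˡ (-1*x≈-x x)) (-‿inverseʳ x)

  -1*-1≈1 : -1# * -1# ≈ 1#
  -1*-1≈1 = begin-equality
    -1# * -1#               ≈⟨ +-identityˡ _ ⟨
    0# + -1# * -1#          ≈⟨ +-congʳ (x+-1*x≈0 1#) ⟨
    1# + -1# * 1# + -1# * -1#
      ≈⟨ solve 1 (λ m → con 1 :+ m :* con 1 :+ m :* m := con 1 :+ m :* (con 1 :+ m)) refl -1# ⟩
    1# + -1# * (1# + -1#)   ≈⟨ +-congˡ (*-congˡ (-‿inverseʳ 1#)) ⟩
    1# + -1# * 0#           ≈⟨ +-congˡ (zeroʳ -1#) ⟩
    1# + 0#                 ≈⟨ +-identityʳ 1# ⟩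
    1#                      ∎

  2xy≤x²+y² : ∀ x y → x * y + x * y ≤ x * x + y * y
  2xy≤x²+y² x y = ∃⇒≤ _ (square-nonneg (x + -1# * y)) (begin-equality
    x * y + x * y + (x + -1# * y) * (x + -1# * y)
      ≈⟨ solve 3 (λ x y m → x :* y :+ x :* y :+ (x :+ m :* y) :* (x :+ m :* y)
           := x :* x :+ m :* m :* (y :* y) :+ (x :* y :+ m :* (x :* y)) :+ (x :* y :+ m :* (x :* y)))
           refl x y -1# ⟩
    x * x + -1# * -1# * (y * y) + (x * y + -1# * (x * y)) + (x * y + -1# * (x * y))
      ≈⟨ +-cong (+-cong (+-congˡ (*-congʳ -1*-1≈1)) (x+-1*x≈0 _)) (x+-1*x≈0 _) ⟩
    x * x + 1# * (y * y) + 0# + 0#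
      ≈⟨ solve 2 (λ a b → a :+ con 1 :* b :+ con 0 :+ con 0 := a :+ b) refl (x * x) (y * y) ⟩
    x * x + y * y ∎)

  ⁻¹-0≤ : ∀ {x} → 0# ≤ x → 0# ≤ x ⁻¹
  ⁻¹-0≤ {x} 0≤x = ≤-respʳ-≈ (begin-equality
    x ⁻¹ * x ⁻¹ * x    ≈⟨ solve 2 (λ x y → y :* y :* x := y :* x :* y) refl x (x ⁻¹) ⟩
    x ⁻¹ * x * x ⁻¹    ≈⟨ x⁻¹*x*x⁻¹≈x⁻¹ x ⟩
    x ⁻¹               ∎)
    (*-nonneg (square-nonneg (x ⁻¹)) 0≤x)

  x*y≈0⇒y≈0 : ∀ {x y} → ¬ x ≈ 0# → x * y ≈ 0# → y ≈ 0#
  x*y≈0⇒y≈0 {x} {y} x≉0 x*y≈0 = begin-equality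
    y               ≈⟨ *-identityˡ y ⟨
    1# * y          ≈⟨ *-congʳ (⁻¹-inverseʳ x x≉0) ⟨
    x * x ⁻¹ * y    ≈⟨ solve 3 (λ x i y → x :* i :* y := i :* (x :* y)) refl x (x ⁻¹) y ⟩
    x ⁻¹ * (x * y)  ≈⟨ trans (*-congˡ x*y≈0) (zeroʳ _) ⟩
    0#              ∎

  x*x≤0⇒x≈0 : ∀ {x} → x * x ≤ 0# → x ≈ 0#
  x*x≤0⇒x≈0 {x} x*x≤0 with x ≟ 0#
  ... | yes x≈0 = x≈0
  ... | no  x≉0 = x*y≈0⇒y≈0 x≉0 (antisym x*x≤0 (square-nonneg x))

  sum-mono-≤ : ∀ {n} {f g : Vector Carrier n} → (∀ i → f i ≤ g i) → sum f ≤ sum g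
  sum-mono-≤ {ℕ.zero}  f≤g = ≤-refl
  sum-mono-≤ {ℕ.suc n} f≤g = +-mono-≤ (f≤g zero) (sum-mono-≤ (f≤g ∘ suc))

  sum-zero : ∀ {n} {f : Vector Carrier n} → (∀ i → f i ≈ 0#) → sum f ≈ 0#
  sum-zero {n} f≈0 = trans (sum-cong-≋ f≈0) (sum-replicate-zero n)

  sum-nonneg : ∀ {n} {f : Vector Carrier n} → (∀ i → 0# ≤ f i) → 0# ≤ sum f
  sum-nonneg {n} 0≤f = ≤-respˡ-≈ (sum-zero {n} λ _ → refl) (sum-mono-≤ 0≤f)

  term≤sum : ∀ {n} {f : Vector Carrier n} → (∀ i → 0# ≤ f i) → ∀ i → f i ≤ sum f
  term≤sum 0≤f zero    = x≤x+y (sum-nonneg (0≤f ∘ suc))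
  term≤sum 0≤f (suc i) = ≤-trans (term≤sum (0≤f ∘ suc) i) (x≤y+x (0≤f zero))

  sum-single : ∀ {n} {f : Vector Carrier n} i → (∀ k → i ≢ k → f k ≈ 0#) → sum f ≈ f i
  sum-single zero f≈0 =
    trans (+-congˡ (sum-zero (λ k → f≈0 (suc k) λ ()))) (+-identityʳ _)
  sum-single (suc i) f≈0 =
    trans (+-cong (f≈0 zero λ ()) (sum-single i λ k i≢k → f≈0 (suc k) (i≢k ∘ Fin.suc-injective)))
          (+-identityˡ _)

  ∑∑ : ∀ {m n} → (Fin m → Fin n → Carrier) → Carrier
  ∑∑ {m} {n} f = ∑[ i < m ] ∑[ j < n ] f i j

  ∑∑-cong : ∀ {m n} {f g : Fin m → Fin n → Carrier} → (∀ i j → f i j ≈ g i j) → ∑∑ f ≈ ∑∑ g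
  ∑∑-cong f≈g = sum-cong-≋ λ i → sum-cong-≋ (f≈g i)

  ∑∑-mono-≤ : ∀ {m n} {f g : Fin m → Fin n → Carrier} → (∀ i j → f i j ≤ g i j) → ∑∑ f ≤ ∑∑ g
  ∑∑-mono-≤ f≤g = sum-mono-≤ λ i → sum-mono-≤ (f≤g i)

  ∑∑-distrib-+ : ∀ {m n} (f g : Fin m → Fin n → Carrier) →
                 ∑∑ (λ i j → f i j + g i j) ≈ ∑∑ f + ∑∑ g
  ∑∑-distrib-+ f g =
    trans (sum-cong-≋ λ i → ∑-distrib-+ (f i) (g i)) (∑-distrib-+ (λ i → sum (f i)) (λ i → sum (g i)))

  *-distribˡ-∑∑ : ∀ {m n} x (f : Fin m → Fin n → Carrier) → x * ∑∑ f ≈ ∑∑ (λ i j → x * f i j)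
  *-distribˡ-∑∑ x f = trans (*-distribˡ-sum x (λ i → sum (f i))) (sum-cong-≋ λ i → *-distribˡ-sum x (f i))

  ∑*∑ : ∀ {m n} (f : Vector Carrier m) (g : Vector Carrier n) →
        sum f * sum g ≈ ∑∑ (λ i j → f i * g j)
  ∑*∑ f g = trans (*-distribʳ-sum (sum g) f) (sum-cong-≋ λ i → *-distribˡ-sum (f i) g)

  symmetrize-≤ : ∀ {n} {f g : Fin n → Fin n → Carrier} →
                 (∀ i j → f i j + f j i ≤ g i j + g j i) → ∑∑ f ≤ ∑∑ g
  symmetrize-≤ {f = f} {g} f≤g =
    double-cancel-≤ (≤-respˡ-≈ (double f) (≤-respʳ-≈ (double g) (∑∑-mono-≤ f≤g)))
    where
    double : ∀ f → ∑∑ (λ i j → f i j + f j i) ≈ ∑∑ f + ∑∑ f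
    double f = trans (∑∑-distrib-+ f (λ i j → f j i)) (+-congˡ (sym (∑-comm f)))

  cauchy-schwarz : ∀ {n} (a b : Vector Carrier n) →
    sum (λ i → a i * b i) * sum (λ i → a i * b i) ≤
    sum (λ i → a i * a i) * sum (λ i → b i * b i)
  cauchy-schwarz a b = begin
    sum (λ i → a i * b i) * sum (λ i → a i * b i)  ≈⟨ ∑*∑ (λ i → a i * b i) (λ i → a i * b i) ⟩
    ∑∑ (λ i j → (a i * b i) * (a j * b j))         ≤⟨ symmetrize-≤ pointwise ⟩
    ∑∑ (λ i j → (a i * a i) * (b j * b j))         ≈⟨ ∑*∑ (λ i → a i * a i) (λ i → b i * b i) ⟨
    sum (λ i → a i * a i) * sum (λ i → b i * b i)  ∎
    where
    pointwise : ∀ i j → (a i * b i) * (a j * b j) + (a j * b j) * (a i * b i) ≤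
                        (a i * a i) * (b j * b j) + (a j * a j) * (b i * b i)
    pointwise i j = begin
      (a i * b i) * (a j * b j) + (a j * b j) * (a i * b i)
        ≈⟨ solve 4 (λ x y z w → (x :* y) :* (z :* w) :+ (z :* w) :* (x :* y)
             := (x :* w) :* (z :* y) :+ (x :* w) :* (z :* y)) refl (a i) (b i) (a j) (b j) ⟩
      (a i * b j) * (a j * b i) + (a i * b j) * (a j * b i)
        ≤⟨ 2xy≤x²+y² _ _ ⟩
      (a i * b j) * (a i * b j) + (a j * b i) * (a j * b i)
        ≈⟨ solve 4 (λ x y z w → (x :* w) :* (x :* w) :+ (z :* y) :* (z :* y)
             := (x :* x) :* (w :* w) :+ (z :* z) :* (y :* y)) refl (a i) (b i) (a j) (b j) ⟩
      (a i * a i) * (b j * b j) + (a j * a j) * (b i * b i) ∎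

  diagonal-diag : ∀ {n} (u : Vector Carrier n) i → diagonal u i i ≈ u i
  diagonal-diag u i with i Fin.≟ i
  ... | yes _  = refl
  ... | no i≢i = contradiction ≡.refl i≢i

  diagonal-off : ∀ {n} (u : Vector Carrier n) {i j} → i ≢ j → diagonal u i j ≈ 0#
  diagonal-off u {i} {j} i≢j with i Fin.≟ j
  ... | yes i≡j = contradiction i≡j i≢j
  ... | no _    = refl

  diagonal-symmetric : ∀ {n} (u : Vector Carrier n) → IsSymmetric (diagonal u)
  diagonal-symmetric u i j with i Fin.≟ j
  ... | yes ≡.refl = diagonal-diag u i
  ... | no  i≢j    = diagonal-off u (i≢j ∘ ≡.sym)

  sum-diagonal-row : ∀ {n} (u f : Vector Carrier n) i → ∑[ j < n ] (diagonal u i j * f j) ≈ u i * f i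
  sum-diagonal-row u f i = trans
    (sum-single i λ k i≢k → trans (*-congʳ (diagonal-off u i≢k)) (zeroˡ _))
    (*-congʳ (diagonal-diag u i))

  sum-diagonal-column : ∀ {n} (u f : Vector Carrier n) j → ∑[ i < n ] (f i * diagonal u i j) ≈ f j * u j
  sum-diagonal-column u f j = trans
    (sum-single j λ k j≢k → trans (*-congˡ (diagonal-off u (j≢k ∘ ≡.sym))) (zeroʳ _))
    (*-congˡ (diagonal-diag u j))

module MatrixForms (ℝ : CompleteOrderedField) where

  open OrderedSums ℝ

  bilinear : ∀ {n} → Matrix n → Vector Carrier n → Vector Carrier n → Carrier
  bilinear A x y = ∑∑ λ i j → x i * A i j * y j

  bilinear-sumˡ : ∀ {n} (A : Matrix n) x x′ y →
    bilinear A (λ i → x i + x′ i) y ≈ bilinear A x y + bilinear A x′ y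
  bilinear-sumˡ A x x′ y = trans
    (∑∑-cong λ i j → trans (*-congʳ (distribʳ (A i j) (x i) (x′ i))) (distribʳ (y j) _ _))
    (∑∑-distrib-+ (λ i j → x i * A i j * y j) (λ i j → x′ i * A i j * y j))

  bilinear-sumʳ : ∀ {n} (A : Matrix n) x y y′ →
    bilinear A x (λ i → y i + y′ i) ≈ bilinear A x y + bilinear A x y′
  bilinear-sumʳ A x y y′ = trans
    (∑∑-cong λ i j → distribˡ (x i * A i j) (y j) (y′ j))
    (∑∑-distrib-+ (λ i j → x i * A i j * y j) (λ i j → x i * A i j * y′ j))

  bilinear-scaleˡ : ∀ {n} (A : Matrix n) t x y → bilinear A (λ i → t * x i) y ≈ t * bilinear A x y
  bilinear-scaleˡ A t x y = trans
    (∑∑-cong λ i j → solve 4 (λ t x a y → t :* x :* a :* y := t :* (x :* a :* y)) refl t (x i) (A i j) (y j))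
    (sym (*-distribˡ-∑∑ t (λ i j → x i * A i j * y j)))

  bilinear-scaleʳ : ∀ {n} (A : Matrix n) t x y → bilinear A x (λ i → t * y i) ≈ t * bilinear A x y
  bilinear-scaleʳ A t x y = trans
    (∑∑-cong λ i j → solve 4 (λ t x a y → x :* a :* (t :* y) := t :* (x :* a :* y)) refl t (x i) (A i j) (y j))
    (sym (*-distribˡ-∑∑ t (λ i j → x i * A i j * y j)))

  bilinear-congˡ : ∀ {n} (A : Matrix n) {x x′} y → (∀ i → x i ≈ x′ i) → bilinear A x y ≈ bilinear A x′ y
  bilinear-congˡ {n} A y x≈x′ = ∑∑-cong {n} {n} λ i j → *-congʳ (*-congʳ (x≈x′ i))

  bilinear-congʳ : ∀ {n} (A : Matrix n) x {y y′} → (∀ i → y i ≈ y′ i) → bilinear A x y ≈ bilinear A x y′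
  bilinear-congʳ {n} A x y≈y′ = ∑∑-cong {n} {n} λ i j → *-congˡ (y≈y′ j)

  bilinear-line : ∀ {n} (A : Matrix n) x u t →
    bilinear A (λ i → x i + t * u i) (λ i → x i + t * u i) ≈
    bilinear A x x + t * (bilinear A x u + bilinear A u x) + t * t * bilinear A u u
  bilinear-line A x u t = begin-equality
    bilinear A (λ i → x i + t * u i) z
      ≈⟨ bilinear-sumˡ A x (λ i → t * u i) z ⟩
    bilinear A x z + bilinear A (λ i → t * u i) z
      ≈⟨ +-cong (right x) (trans (bilinear-scaleˡ A t u z) (*-congˡ (right u))) ⟩
    (bilinear A x x + t * bilinear A x u) + t * (bilinear A u x + t * bilinear A u u)
      ≈⟨ solve 5 (λ t a b c e → (a :+ t :* b) :+ t :* (c :+ t :* e)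
           := a :+ t :* (b :+ c) :+ t :* t :* e) refl t _ _ _ _ ⟩
    bilinear A x x + t * (bilinear A x u + bilinear A u x) + t * t * bilinear A u u ∎
    where
    z = λ i → x i + t * u i
    right : ∀ v → bilinear A v z ≈ bilinear A v x + t * bilinear A v u
    right v = trans (bilinear-sumʳ A v x (λ i → t * u i)) (+-congˡ (bilinear-scaleʳ A t v u))

  basis : ∀ {n} → Fin n → Vector Carrier n
  basis i = 𝐈 i

  bilinear-basisˡ : ∀ {n} (A : Matrix n) k y → bilinear A (basis k) y ≈ ∑[ j < n ] (A k j * y j)
  bilinear-basisˡ {n} A k y = begin-equality
    ∑∑ (λ i j → basis k i * A i j * y j)
      ≈⟨ sum-cong-≋ (λ i → trans (sum-cong-≋ {n} λ j → *-assoc _ _ _) (sym (*-distribˡ-sum (basis k i) (λ j → A i j * y j)))) ⟩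
    ∑[ i < n ] (basis k i * ∑[ j < n ] (A i j * y j))
      ≈⟨ sum-diagonal-row (λ _ → 1#) (λ i → ∑[ j < n ] (A i j * y j)) k ⟩
    1# * ∑[ j < n ] (A k j * y j)
      ≈⟨ *-identityˡ _ ⟩
    ∑[ j < n ] (A k j * y j) ∎

  bilinear-basis : ∀ {n} (A : Matrix n) k l → bilinear A (basis k) (basis l) ≈ A k l
  bilinear-basis {n} A k l = begin-equality
    bilinear A (basis k) (basis l)    ≈⟨ bilinear-basisˡ A k (basis l) ⟩
    ∑[ j < n ] (A k j * basis l j)    ≈⟨ sum-cong-≋ {n} (λ j → *-comm _ _) ⟩
    ∑[ j < n ] (basis l j * A k j)    ≈⟨ sum-diagonal-row (λ _ → 1#) (A k) l ⟩
    1# * A k l                        ≈⟨ *-identityˡ _ ⟩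
    A k l                             ∎

  difference : ∀ {n} → Fin n → Fin n → Vector Carrier n
  difference k l i = basis k i + -1# * basis l i

  bilinear-difference : ∀ {n} (A : Matrix n) k l →
    bilinear A (difference k l) (difference k l) + (A k l + A l k) ≈ A k k + A l l
  bilinear-difference A k l = begin-equality
    bilinear A (difference k l) (difference k l) + (A k l + A l k)
      ≈⟨ +-congʳ (bilinear-line A (basis k) (basis l) -1#) ⟩
    bilinear A (basis k) (basis k) + -1# * (bilinear A (basis k) (basis l) + bilinear A (basis l) (basis k))
      + -1# * -1# * bilinear A (basis l) (basis l) + (A k l + A l k)
      ≈⟨ +-congʳ (+-cong (+-cong (bilinear-basis A k k) (*-congˡ (+-cong (bilinear-basis A k l) (bilinear-basis A l k))))
                         (*-cong -1*-1≈1 (bilinear-basis A l l))) ⟩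
    A k k + -1# * (A k l + A l k) + 1# * A l l + (A k l + A l k)
      ≈⟨ solve 4 (λ m a b c → a :+ m :* b :+ con 1 :* c :+ b := a :+ c :+ (b :+ m :* b))
           refl -1# (A k k) (A k l + A l k) (A l l) ⟩
    A k k + A l l + ((A k l + A l k) + -1# * (A k l + A l k))
      ≈⟨ +-congˡ (x+-1*x≈0 _) ⟩
    A k k + A l l + 0#
      ≈⟨ +-identityʳ _ ⟩
    A k k + A l l ∎

  DNN-entry≤trace : ∀ {n} {Z : Matrix n} → DoublyNonnegative Z → ∀ i j → Z i j ≤ trace Z
  DNN-entry≤trace {Z = Z} ((Z-sym , Z-psd) , 0≤Z) i j = double-cancel-≤ (begin
    Z i j + Z i j  ≈⟨ +-congˡ (Z-sym i j) ⟨
    Z i j + Z j i  ≤⟨ x≤y+x (Z-psd (difference i j)) ⟩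
    bilinear Z (difference i j) (difference i j) + (Z i j + Z j i)  ≈⟨ bilinear-difference Z i j ⟩
    Z i i + Z j j  ≤⟨ +-mono-≤ (term≤sum (λ k → 0≤Z k k) i) (term≤sum (λ k → 0≤Z k k) j) ⟩
    trace Z + trace Z ∎)

  DNN-scale : ∀ {n} {Z : Matrix n} c → 0# ≤ c → DoublyNonnegative Z → DoublyNonnegative (c · Z)
  DNN-scale {Z = Z} c 0≤c ((Z-sym , Z-psd) , 0≤Z) =
    ((λ i j → *-congˡ (Z-sym i j)) , λ x → ≤-respʳ-≈ (trans (*-distribˡ-∑∑ c (λ i j → x i * Z i j * x j))
      (∑∑-cong λ i j → solve 3 (λ c a b → c :* (a :* b) := c :* a :* b) refl c _ _ ⟨≈⟩
         *-congʳ (solve 3 (λ c a b → c :* (a :* b) := a :* (c :* b)) refl c (x i) (Z i j))))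
      (*-nonneg 0≤c (Z-psd x))) ,
    λ i j → *-nonneg 0≤c (0≤Z i j)
    where
    infixr 5 _⟨≈⟩_
    _⟨≈⟩_ = trans

  ⟨outer,⟩ : ∀ {n} (x : Vector Carrier n) Z → ⟨ outer x , Z ⟩ ≈ bilinear Z x x
  ⟨outer,⟩ x Z = trans
    (∑-comm (λ i k → outer x i k * Z k i))
    (∑∑-cong λ k i → solve 3 (λ a b z → a :* b :* z := b :* z :* a) refl (x i) (x k) (Z k i))

  ⟨𝐈,⟩ : ∀ {n} (Z : Matrix n) → ⟨ 𝐈 , Z ⟩ ≈ trace Z
  ⟨𝐈,⟩ Z = sum-cong-≋ λ i → trans (sum-diagonal-row (λ _ → 1#) (λ k → Z k i) i) (*-identityˡ _)

  diagonal-sandwich : ∀ {n} (u v : Vector Carrier n) M i j →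
    (diagonal u ⊗ M ⊗ diagonal v) i j ≈ u i * M i j * v j
  diagonal-sandwich u v M i j = trans
    (sum-diagonal-column v (λ k → (diagonal u ⊗ M) i k) j)
    (*-congʳ (sum-diagonal-row u (λ k → M k j) i))

  bilinear-outer : ∀ {n} (x y : Vector Carrier n) →
    bilinear (outer x) y y ≈ sum (λ i → x i * y i) * sum (λ i → x i * y i)
  bilinear-outer x y = trans
    (∑∑-cong λ i j → solve 4 (λ a b c d → c :* (a :* b) :* d := a :* c :* (b :* d)) refl (x i) (x j) (y i) (y j))
    (sym (∑*∑ (λ i → x i * y i) (λ i → x i * y i)))

  outer-DNN : ∀ {n} (x : Vector Carrier n) → NonNegative x → DoublyNonnegative (outer x)
  outer-DNN x 0≤x =
    ((λ i j → *-comm (x j) (x i)) , λ y → ≤-respʳ-≈ (sym (bilinear-outer x y)) (square-nonneg _)) ,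
    λ i j → *-nonneg (0≤x i) (0≤x j)

  outer-CP : ∀ {n} (x : Vector Carrier n) → NonNegative x → CompletelyPositive (outer x)
  outer-CP x 0≤x = 1 , (λ _ → x) , (λ _ → 0≤x) , λ i j → sym (+-identityʳ _)

  CP-symmetric : ∀ {n} {Z : Matrix n} → CompletelyPositive Z → IsSymmetric Z
  CP-symmetric (k , x , _ , Z≈) i j =
    trans (Z≈ j i) (trans (sum-cong-≋ λ l → *-comm (x l j) (x l i)) (sym (Z≈ i j)))

  CP-nonneg : ∀ {n} {Z : Matrix n} → CompletelyPositive Z → ∀ i j → 0# ≤ Z i j
  CP-nonneg (k , x , 0≤x , Z≈) i j =
    ≤-respʳ-≈ (sym (Z≈ i j)) (sum-nonneg λ l → *-nonneg (0≤x l i) (0≤x l j))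

  ⟨,⟩-CP : ∀ {n k} (A Z : Matrix n) (x : Vector (Vector Carrier n) k) →
           Z ≈ᴹ (λ i j → ∑[ l < k ] outer (x l) i j) →
           ⟨ A , Z ⟩ ≈ ∑[ l < k ] ⟨ A , outer (x l) ⟩
  ⟨,⟩-CP {n} {k} A Z x Z≈ = begin-equality
    ∑∑ (λ i j → A i j * Z j i)
      ≈⟨ ∑∑-cong (λ i j → trans (*-congˡ (Z≈ j i)) (*-distribˡ-sum (A i j) (λ l → outer (x l) j i))) ⟩
    ∑∑ (λ i j → ∑[ l < k ] (A i j * outer (x l) j i))
      ≈⟨ sum-cong-≋ (λ i → ∑-comm (λ j l → A i j * outer (x l) j i)) ⟩
    ∑∑ (λ i l → ∑[ j < n ] (A i j * outer (x l) j i))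
      ≈⟨ ∑-comm (λ i l → ∑[ j < n ] (A i j * outer (x l) j i)) ⟩
    ∑[ l < k ] ⟨ A , outer (x l) ⟩ ∎

  adjacency-cases : ∀ {n} (G : Graph n) i j →
    Graph.Adjacent G i j × adjacency G i j ≈ 1# ⊎ ¬ Graph.Adjacent G i j × adjacency G i j ≈ 0#
  adjacency-cases G i j with Graph.adjacent? G i j
  ... | yes p = inj₁ (p , refl)
  ... | no ¬p = inj₂ (¬p , refl)

  adjacency-symmetric : ∀ {n} (G : Graph n) → IsSymmetric (adjacency G)
  adjacency-symmetric G i j with adjacency-cases G i j | adjacency-cases G j i
  ... | inj₁ (_ , p)  | inj₁ (_ , q)  = trans q (sym p)
  ... | inj₂ (_ , p)  | inj₂ (_ , q)  = trans q (sym p)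
  ... | inj₁ (x , _)  | inj₂ (¬x , _) = contradiction (Graph.symmetric G x) ¬x
  ... | inj₂ (¬x , _) | inj₁ (x , _)  = contradiction (Graph.symmetric G x) ¬x

  adjacency-diag : ∀ {n} (G : Graph n) i → adjacency G i i ≈ 0#
  adjacency-diag G i with adjacency-cases G i i
  ... | inj₁ (ii , _) = contradiction ii (Graph.loopless G ≡.refl)
  ... | inj₂ (_ , p)  = p

  adjacency-nonneg : ∀ {n} (G : Graph n) i j → 0# ≤ adjacency G i j
  adjacency-nonneg G i j with adjacency-cases G i j
  ... | inj₁ (_ , p) = ≤-respʳ-≈ (sym p) 0≤1
  ... | inj₂ (_ , p) = ≤-reflexive (sym p)

  basis-cases : ∀ {n} (i k : Fin n) → (i ≡ k × basis i k ≈ 1#) ⊎ basis i k ≈ 0#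
  basis-cases i k with i Fin.≟ k
  ... | yes i≡k = inj₁ (i≡k , refl)
  ... | no  _   = inj₂ refl

  basis-nonneg : ∀ {n} (i : Fin n) → NonNegative (basis i)
  basis-nonneg i k with basis-cases i k
  ... | inj₁ (_ , p) = ≤-respʳ-≈ (sym p) 0≤1
  ... | inj₂ p       = ≤-reflexive (sym p)
  ⟨,⟩-scale : ∀ {n} (A : Matrix n) c Z → ⟨ A , c · Z ⟩ ≈ c * ⟨ A , Z ⟩
  ⟨,⟩-scale A c Z = trans
    (∑∑-cong λ i j → solve 3 (λ a c z → a :* (c :* z) := c :* (a :* z)) refl (A i j) c (Z j i))
    (sym (*-distribˡ-∑∑ c (λ i j → A i j * Z j i)))

module Weighting (ℝ : CompleteOrderedField) {n : ℕ} (G : Graph n) (w : Vector (CompleteOrderedField.Carrier ℝ) n) where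

  open OrderedSums ℝ
  open MatrixForms ℝ

  s r d : Vector Carrier n
  s = √ᵛ w
  r i = s i ⁻¹
  d i = s i * r i

  0≤s : ∀ i → 0# ≤ s i
  0≤s i = √-nonneg (w i)

  0≤r : ∀ i → 0# ≤ r i
  0≤r i = ⁻¹-0≤ (0≤s i)

  0≤d : ∀ i → 0# ≤ d i
  0≤d i = *-nonneg (0≤s i) (0≤r i)

  d*s≈s : ∀ i → d i * s i ≈ s i
  d*s≈s i = x*x⁻¹*x≈x (s i)

  d*r≈r : ∀ i → d i * r i ≈ r i
  d*r≈r i = trans (*-congʳ (*-comm _ _)) (x⁻¹*x*x⁻¹≈x⁻¹ (s i))

  d≤1 : ∀ i → d i ≤ 1#
  d≤1 i with s i ≟ 0#
  ... | yes s≈0 = ≤-respˡ-≈ (sym (zeroʳ (s i))) 0≤1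
  ... | no  s≉0 = ≤-reflexive (proj₂ (invertible (s i) s≉0))

  Ā : Matrix n
  Ā = adjacency (complement G)

  I+Ā : Matrix n
  I+Ā = 𝐈 ⊕ Ā

  I+Ā-symmetric : IsSymmetric I+Ā
  I+Ā-symmetric i j = +-cong (diagonal-symmetric (λ _ → 1#) i j) (adjacency-symmetric (complement G) i j)

  sum-I+Ā : ∀ (f : Fin n → Fin n → Carrier) →
    ∑∑ (λ i j → I+Ā i j * f i j) ≈ ∑[ i < n ] f i i + ∑∑ (λ i j → Ā i j * f i j)
  sum-I+Ā f = begin-equality
    ∑∑ (λ i j → I+Ā i j * f i j)
      ≈⟨ ∑∑-cong (λ i j → distribʳ (f i j) (𝐈 i j) (Ā i j)) ⟩
    ∑∑ (λ i j → 𝐈 i j * f i j + Ā i j * f i j)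
      ≈⟨ ∑∑-distrib-+ (λ i j → 𝐈 i j * f i j) (λ i j → Ā i j * f i j) ⟩
    ∑∑ (λ i j → 𝐈 i j * f i j) + ∑∑ (λ i j → Ā i j * f i j)
      ≈⟨ +-congʳ (sum-cong-≋ λ i → trans (sum-diagonal-row (λ _ → 1#) (f i) i) (*-identityˡ _)) ⟩
    ∑[ i < n ] f i i + ∑∑ (λ i j → Ā i j * f i j) ∎

  M : Matrix n
  M = weighted w I+Ā

  ½+½≈1 : ½ + ½ ≈ 1#
  ½+½≈1 = trans (solve 1 (λ h → h :+ h := (con 1 :+ con 1) :* h) refl ½)
                (⁻¹-inverseʳ (1# + 1#) (0≤x⇒x+1≉0 0≤1))

  ⟨M,⟩ : ∀ {Z} → IsSymmetric Z → ⟨ M , Z ⟩ ≈ ∑∑ (λ i j → I+Ā i j * (r i * s j * Z i j))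
  ⟨M,⟩ {Z} Z-sym = begin-equality
    ∑∑ (λ i j → M i j * Z j i)
      ≈⟨ ∑∑-cong (λ i j → *-congʳ (*-congˡ (+-cong (diagonal-sandwich s r I+Ā i j) (diagonal-sandwich r s I+Ā i j)))) ⟩
    ∑∑ (λ i j → ½ * (s i * I+Ā i j * r j + r i * I+Ā i j * s j) * Z j i)
      ≈⟨ ∑∑-cong (λ i j → trans
           (solve 7 (λ h si sj ri rj m z → h :* (si :* m :* rj :+ ri :* m :* sj) :* z
                                         := h :* (m :* (ri :* sj :* z)) :+ h :* (m :* (rj :* si :* z)))
             refl ½ (s i) (s j) (r i) (r j) (I+Ā i j) (Z j i))
           (+-cong (*-congˡ (*-congˡ (*-congˡ (Z-sym i j)))) (*-congˡ (*-congʳ (I+Ā-symmetric j i))))) ⟩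
    ∑∑ (λ i j → ½ * f i j + ½ * f j i)
      ≈⟨ ∑∑-distrib-+ (λ i j → ½ * f i j) (λ i j → ½ * f j i) ⟩
    ∑∑ (λ i j → ½ * f i j) + ∑∑ (λ i j → ½ * f j i)
      ≈⟨ +-congˡ (∑-comm (λ i j → ½ * f j i)) ⟩
    ∑∑ (λ i j → ½ * f i j) + ∑∑ (λ i j → ½ * f i j)
      ≈⟨ +-cong (*-distribˡ-∑∑ ½ f) (*-distribˡ-∑∑ ½ f) ⟨
    ½ * ∑∑ f + ½ * ∑∑ f
      ≈⟨ distribʳ (∑∑ f) ½ ½ ⟨
    (½ + ½) * ∑∑ f
      ≈⟨ trans (*-congʳ ½+½≈1) (*-identityˡ _) ⟩
    ∑∑ f ∎
    where
    f : Fin n → Fin n → Carrier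
    f i j = I+Ā i j * (r i * s j * Z i j)

  ⟨M,⟩≤trace : ∀ {Z} → IsSymmetric Z → (∀ i j → 0# ≤ Z i j) → Z ⊙ Ā ≈ᴹ 𝟎 → ⟨ M , Z ⟩ ≤ trace Z
  ⟨M,⟩≤trace {Z} Z-sym 0≤Z Z⊙Ā≈0 = begin
    ⟨ M , Z ⟩
      ≈⟨ ⟨M,⟩ Z-sym ⟩
    ∑∑ (λ i j → I+Ā i j * f i j)
      ≈⟨ sum-I+Ā f ⟩
    ∑[ i < n ] f i i + ∑∑ (λ i j → Ā i j * f i j)
      ≈⟨ +-congˡ (sum-zero λ i → sum-zero λ j → begin-equality
           Ā i j * f i j              ≈⟨ solve 4 (λ a r s z → a :* (r :* s :* z) := r :* s :* (z :* a)) refl (Ā i j) (r i) (s j) (Z i j) ⟩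
           r i * s j * (Z i j * Ā i j) ≈⟨ *-congˡ (Z⊙Ā≈0 i j) ⟩
           r i * s j * 0#             ≈⟨ zeroʳ _ ⟩
           0#                         ∎) ⟩
    ∑[ i < n ] f i i + 0#
      ≈⟨ +-identityʳ _ ⟩
    ∑[ i < n ] f i i
      ≤⟨ sum-mono-≤ (λ i → begin
           r i * s i * Z i i  ≈⟨ *-congʳ (*-comm _ _) ⟩
           d i * Z i i        ≤⟨ *-monoʳ-≤ (Z i i) (0≤Z i i) (d≤1 i) ⟩
           1# * Z i i         ≈⟨ *-identityˡ _ ⟩
           Z i i              ∎) ⟩
    trace Z ∎
    where
    f : Fin n → Fin n → Carrier
    f i j = r i * s j * Z i j

  vertex? : ∀ m → Fin m ⊎ ¬ Fin m
  vertex? ℕ.zero    = inj₂ λ ()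
  vertex? (ℕ.suc m) = inj₁ zero

  objective : Matrix n → Carrier
  objective Z = ⟨ outer s , Z ⟩

  objective-outer : ∀ x → objective (outer x) ≈ sum (λ i → x i * s i) * sum (λ i → x i * s i)
  objective-outer x = trans (⟨outer,⟩ s (outer x)) (bilinear-outer x s)

  objective-basis : ∀ i → objective (outer (basis i)) ≈ s i * s i
  objective-basis i = trans (objective-outer (basis i)) (*-cong ∑≈sᵢ ∑≈sᵢ)
    where
    ∑≈sᵢ : sum (λ k → basis i k * s k) ≈ s i
    ∑≈sᵢ = trans (sum-diagonal-row (λ _ → 1#) s i) (*-identityˡ _)

  bounded-at-basis⇒≉0 : ∀ {v i} → ¬ s i ≈ 0# →
    objective (outer (basis i)) ≤ v * ⟨ M , outer (basis i) ⟩ → ¬ v ≈ 0#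
  bounded-at-basis⇒≉0 {v} {i} sᵢ≉0 bound v≈0 = sᵢ≉0 (x*x≤0⇒x≈0 (begin
    s i * s i                     ≈⟨ objective-basis i ⟨
    objective (outer (basis i))   ≤⟨ bound ⟩
    v * ⟨ M , outer (basis i) ⟩   ≈⟨ trans (*-congʳ v≈0) (zeroˡ _) ⟩
    0#                            ∎))

  module _ (𝒦 : Matrix n → Set) where

    open Maximization (definingProgram 𝒦 G w) using () renaming (Feasible to Feasible₁)
    open Maximization (weightedProgram 𝒦 G w) using () renaming (Feasible to Feasible₂)

    outer-feasible : ∀ {x} → sum (λ i → x i * x i) ≈ 1# → outer x ⊙ Ā ≈ᴹ 𝟎 → 𝒦 (outer x) → Feasible₁ (outer x)
    outer-feasible {x} ∑x²≈1 x⊙Ā≈0 𝒦x = trans (⟨𝐈,⟩ (outer x)) ∑x²≈1 , x⊙Ā≈0 , 𝒦x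

    outer-basis-feasible : ∀ i → 𝒦 (outer (basis i)) → Feasible₁ (outer (basis i))
    outer-basis-feasible i = outer-feasible ∑≈1 ⊙Ā≈0
      where
      ∑≈1 : sum (λ k → basis i k * basis i k) ≈ 1#
      ∑≈1 = trans (sum-diagonal-row (λ _ → 1#) (basis i) i)
                  (trans (*-identityˡ _) (diagonal-diag (λ _ → 1#) i))
      ⊙Ā≈0 : outer (basis i) ⊙ Ā ≈ᴹ 𝟎
      ⊙Ā≈0 k l with basis-cases i k | basis-cases i l
      ... | inj₁ (≡.refl , _) | inj₁ (≡.refl , _) = trans (*-congˡ (adjacency-diag (complement G) i)) (zeroʳ _)
      ... | inj₂ p            | _                 = trans (*-congʳ (trans (*-congʳ p) (zeroˡ _))) (zeroˡ _)
      ... | inj₁ _            | inj₂ q            = trans (*-congʳ (trans (*-congˡ q) (zeroʳ _))) (zeroˡ _)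

    module _ (𝒦-symmetric : ∀ {Z} → 𝒦 Z → IsSymmetric Z)
             (𝒦-nonneg : ∀ {Z} → 𝒦 Z → ∀ i j → 0# ≤ Z i j) where

      common-maximum : ∀ {v} → ¬ v ≈ 0# →
        (∃[ Z ] Feasible₁ Z × objective Z ≈ v) →
        (∀ Z → 𝒦 Z → objective Z ≤ v * ⟨ M , Z ⟩) →
        v IsMaximumOf definingProgram 𝒦 G w × v IsMaximumOf weightedProgram 𝒦 G w
      common-maximum {v} v≉0 (Z₀ , feasible@(tr≈1 , Z₀⊙Ā≈0 , 𝒦Z₀) , obj≈v) bound =
        ((Z₀ , feasible , obj≈v) , λ Z (tr≈1 , Z⊙Ā≈0 , 𝒦Z) → begin
          objective Z      ≤⟨ bound Z 𝒦Z ⟩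
          v * ⟨ M , Z ⟩    ≤⟨ *-monoˡ-≤ v 0≤v (⟨M,Z⟩≤1 Z (tr≈1 , Z⊙Ā≈0 , 𝒦Z)) ⟩
          v * 1#           ≈⟨ *-identityʳ v ⟩
          v                ∎) ,
        ((Z₀ , (⟨M,Z₀⟩≈1 , 𝒦Z₀) , obj≈v) , λ Z (⟨M,Z⟩≈1 , 𝒦Z) → begin
          objective Z      ≤⟨ bound Z 𝒦Z ⟩
          v * ⟨ M , Z ⟩    ≈⟨ *-congˡ ⟨M,Z⟩≈1 ⟩
          v * 1#           ≈⟨ *-identityʳ v ⟩
          v                ∎)
        where
        0≤v : 0# ≤ v
        0≤v = ≤-respʳ-≈ obj≈v (sum-nonneg λ k → sum-nonneg λ l →
          *-nonneg (*-nonneg (0≤s k) (0≤s l)) (𝒦-nonneg 𝒦Z₀ l k))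
        ⟨M,Z⟩≤1 : ∀ Z → Feasible₁ Z → ⟨ M , Z ⟩ ≤ 1#
        ⟨M,Z⟩≤1 Z (tr≈1 , Z⊙Ā≈0 , 𝒦Z) = ≤-respʳ-≈ (trans (sym (⟨𝐈,⟩ Z)) tr≈1)
          (⟨M,⟩≤trace (𝒦-symmetric 𝒦Z) (𝒦-nonneg 𝒦Z) Z⊙Ā≈0)
        v⁻¹*[v*x]≈x : ∀ x → v ⁻¹ * (v * x) ≈ x
        v⁻¹*[v*x]≈x x = begin-equality
          v ⁻¹ * (v * x)  ≈⟨ solve 3 (λ i v x → i :* (v :* x) := v :* i :* x) refl (v ⁻¹) v x ⟩
          v * v ⁻¹ * x    ≈⟨ *-congʳ (⁻¹-inverseʳ v v≉0) ⟩
          1# * x          ≈⟨ *-identityˡ x ⟩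
          x               ∎
        ⟨M,Z₀⟩≈1 : ⟨ M , Z₀ ⟩ ≈ 1#
        ⟨M,Z₀⟩≈1 = antisym (⟨M,Z⟩≤1 Z₀ feasible) (begin
          1#                        ≈⟨ v⁻¹*[v*x]≈x 1# ⟨
          v ⁻¹ * (v * 1#)           ≈⟨ *-congˡ (trans (*-identityʳ v) (sym obj≈v)) ⟩
          v ⁻¹ * objective Z₀       ≤⟨ *-monoˡ-≤ (v ⁻¹) (⁻¹-0≤ 0≤v) (bound Z₀ 𝒦Z₀) ⟩
          v ⁻¹ * (v * ⟨ M , Z₀ ⟩)   ≈⟨ v⁻¹*[v*x]≈x _ ⟩
          ⟨ M , Z₀ ⟩                ∎)

      module _ (s≈0 : ∀ i → s i ≈ 0#) (𝒦-basis : ∀ i → 𝒦 (outer (basis i))) where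

        objective≈0 : ∀ Z → objective Z ≈ 0#
        objective≈0 Z = sum-zero λ i → sum-zero {n} λ k →
          trans (*-congʳ (trans (*-congʳ (s≈0 i)) (zeroˡ (s k)))) (zeroˡ (Z k i))

        weighted-infeasible : ¬ ∃ Feasible₂
        weighted-infeasible (Z , ⟨M,Z⟩≈1 , 𝒦Z) = 1≉0 (begin-equality
          1#          ≈⟨ ⟨M,Z⟩≈1 ⟨
          ⟨ M , Z ⟩   ≈⟨ ⟨M,⟩ (𝒦-symmetric 𝒦Z) ⟩
          ∑∑ (λ i j → I+Ā i j * (r i * s j * Z i j))
            ≈⟨ sum-zero (λ i → sum-zero {n} λ j → begin-equality
                 I+Ā i j * (r i * s j * Z i j)  ≈⟨ *-congˡ (*-congʳ (*-congˡ (s≈0 j))) ⟩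
                 I+Ā i j * (r i * 0# * Z i j)
                   ≈⟨ solve 3 (λ m r z → m :* (r :* con 0 :* z) := con 0) refl (I+Ā i j) (r i) (Z i j) ⟩
                 0# ∎) ⟩
          0#          ∎)

        zero-common-value : 0# IsValueOf definingProgram 𝒦 G w × 0# IsValueOf weightedProgram 𝒦 G w
        zero-common-value = defining-value , inj₂ (weighted-infeasible , refl)
          where
          defining-value : 0# IsValueOf definingProgram 𝒦 G w
          defining-value with vertex? n
          ... | inj₁ i  = inj₁ ((outer (basis i) , outer-basis-feasible i (𝒦-basis i) , objective≈0 _) ,
                                λ Z _ → ≤-reflexive (objective≈0 Z))
          ... | inj₂ ¬i = inj₂ ((λ (Z , tr≈1 , _) →
                                  1≉0 (trans (sym tr≈1) (sum-zero λ i → contradiction i ¬i))) , refl)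

module ClearNonEdges (ℝ : CompleteOrderedField) {n : ℕ} (G : Graph n) (w : Vector (CompleteOrderedField.Carrier ℝ) n) where

  open OrderedSums ℝ
  open MatrixForms ℝ
  open Weighting ℝ G w

  d*d≈d : ∀ i → d i * d i ≈ d i
  d*d≈d i = trans (sym (*-assoc _ _ _)) (*-congʳ (d*s≈s i))

  H : Matrix n
  H i j = 1# + -1# * Ā i j

  H+Ā≈1 : ∀ i j → H i j + Ā i j ≈ 1#
  H+Ā≈1 i j = begin-equality
    1# + -1# * Ā i j + Ā i j    ≈⟨ solve 2 (λ m a → con 1 :+ m :* a :+ a := con 1 :+ (a :+ m :* a)) refl -1# (Ā i j) ⟩
    1# + (Ā i j + -1# * Ā i j)  ≈⟨ +-congˡ (x+-1*x≈0 _) ⟩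
    1# + 0#                     ≈⟨ +-identityʳ _ ⟩
    1#                          ∎

  H*Ā≈0 : ∀ i j → H i j * Ā i j ≈ 0#
  H*Ā≈0 i j with adjacency-cases (complement G) i j
  ... | inj₁ (_ , p) = trans (*-congʳ (trans (+-congˡ (*-congˡ p)) (x+-1*x≈0 1#))) (zeroˡ _)
  ... | inj₂ (_ , p) = trans (*-congˡ p) (zeroʳ _)

  H-nonneg : ∀ i j → 0# ≤ H i j
  H-nonneg i j with adjacency-cases (complement G) i j
  ... | inj₁ (_ , p) = ≤-reflexive (sym (trans (+-congˡ (*-congˡ p)) (x+-1*x≈0 1#)))
  ... | inj₂ (_ , p) = ≤-respʳ-≈ (sym (trans (+-congˡ (trans (*-congˡ p) (zeroʳ _))) (+-identityʳ _))) 0≤1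

  H-symmetric : IsSymmetric H
  H-symmetric i j = +-congˡ (*-congˡ (adjacency-symmetric (complement G) i j))

  H-diag : ∀ i → H i i ≈ 1#
  H-diag i = trans (sym (trans (+-congˡ (adjacency-diag (complement G) i)) (+-identityʳ _))) (H+Ā≈1 i i)

  module _ {Z : Matrix n} (Z-dnn : DoublyNonnegative Z) where

    Z-symmetric : IsSymmetric Z
    Z-symmetric = proj₁ (proj₁ Z-dnn)

    K N : Matrix n
    K i j = d i * d j * Z i j
    N i j = Ā i j * K i j

    load : Vector Carrier n
    load i = ∑[ j < n ] (N i j * (s j * r i))

    -- K plus, for each i < j nonadjacent, the nonnegative multiple
    -- Kᵢⱼ sᵢ sⱼ v vᵀ of the rank-one matrix of v = eᵢ / sᵢ − eⱼ / sⱼ, which is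
    -- orthogonal to s.
    cleared : Matrix n
    cleared i j = H i j * K i j + diagonal load i j

    K-nonneg : ∀ i j → 0# ≤ K i j
    K-nonneg i j = *-nonneg (*-nonneg (0≤d i) (0≤d j)) (proj₂ Z-dnn i j)

    K-symmetric : IsSymmetric K
    K-symmetric i j = *-cong (*-comm _ _) (Z-symmetric i j)

    N-symmetric : IsSymmetric N
    N-symmetric i j = *-cong (adjacency-symmetric (complement G) i j) (K-symmetric i j)

    N-nonneg : ∀ i j → 0# ≤ N i j
    N-nonneg i j = *-nonneg (adjacency-nonneg (complement G) i j) (K-nonneg i j)

    N*dd≈N : ∀ i j → N i j * (d i * d j) ≈ N i j
    N*dd≈N i j = begin-equality
      Ā i j * (d i * d j * Z i j) * (d i * d j)
        ≈⟨ solve 4 (λ a x y z → a :* (x :* y :* z) :* (x :* y) := a :* (x :* x :* (y :* y) :* z)) refl (Ā i j) (d i) (d j) (Z i j) ⟩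
      Ā i j * (d i * d i * (d j * d j) * Z i j)
        ≈⟨ *-congˡ (*-congʳ (*-cong (d*d≈d i) (d*d≈d j))) ⟩
      N i j ∎

    load-nonneg : ∀ i → 0# ≤ load i
    load-nonneg i = sum-nonneg λ j → *-nonneg (N-nonneg i j) (*-nonneg (0≤s j) (0≤r i))

    diagonal-nonneg : ∀ i j → 0# ≤ diagonal load i j
    diagonal-nonneg i j with i Fin.≟ j
    ... | yes _ = load-nonneg i
    ... | no _  = ≤-refl

    bilinear-cleared : ∀ x → bilinear cleared x x ≈
      ∑∑ (λ i j → H i j * K i j * (x i * x j)) + ∑∑ (λ i j → N i j * (s j * r i) * (x i * x i))
    bilinear-cleared x = begin-equality
      ∑∑ (λ i j → x i * (H i j * K i j + diagonal load i j) * x j)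
        ≈⟨ ∑∑-cong (λ i j → solve 4 (λ x h e y → x :* (h :+ e) :* y := h :* (x :* y) :+ e :* (x :* y))
             refl (x i) (H i j * K i j) (diagonal load i j) (x j)) ⟩
      ∑∑ (λ i j → H i j * K i j * (x i * x j) + diagonal load i j * (x i * x j))
        ≈⟨ ∑∑-distrib-+ (λ i j → H i j * K i j * (x i * x j)) (λ i j → diagonal load i j * (x i * x j)) ⟩
      ∑∑ (λ i j → H i j * K i j * (x i * x j)) + ∑∑ (λ i j → diagonal load i j * (x i * x j))
        ≈⟨ +-congˡ (sum-cong-≋ λ i → trans (sum-diagonal-row load (λ j → x i * x j) i)
             (*-distribʳ-sum (x i * x i) (λ j → N i j * (s j * r i)))) ⟩
      ∑∑ (λ i j → H i j * K i j * (x i * x j)) + ∑∑ (λ i j → N i j * (s j * r i) * (x i * x i)) ∎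

    HK+N : ∀ (x : Vector Carrier n) → ∑∑ (λ i j → H i j * K i j * (x i * x j)) + ∑∑ (λ i j → N i j * (x i * x j)) ≈
           bilinear Z (λ i → d i * x i) (λ i → d i * x i)
    HK+N x = begin-equality
      ∑∑ (λ i j → H i j * K i j * (x i * x j)) + ∑∑ (λ i j → N i j * (x i * x j))
        ≈⟨ ∑∑-distrib-+ (λ i j → H i j * K i j * (x i * x j)) (λ i j → N i j * (x i * x j)) ⟨
      ∑∑ (λ i j → H i j * K i j * (x i * x j) + N i j * (x i * x j))
        ≈⟨ ∑∑-cong (λ i j → trans
             (solve 7 (λ h a p q z x y → h :* (p :* q :* z) :* (x :* y) :+ a :* (p :* q :* z) :* (x :* y)
                := (h :+ a) :* (p :* x :* z :* (q :* y))) refl (H i j) (Ā i j) (d i) (d j) (Z i j) (x i) (x j))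
             (trans (*-congʳ (H+Ā≈1 i j)) (*-identityˡ _))) ⟩
      bilinear Z (λ i → d i * x i) (λ i → d i * x i) ∎

    cleared-DNN : DoublyNonnegative cleared
    cleared-DNN = (symmetric , psd) , λ i j →
      +-nonneg (*-nonneg (H-nonneg i j) (K-nonneg i j)) (diagonal-nonneg i j)
      where
      symmetric : IsSymmetric cleared
      symmetric i j = +-cong (*-cong (H-symmetric i j) (K-symmetric i j)) (diagonal-symmetric load i j)

      module _ (x : Vector Carrier n) where

        half : ∀ i j → N i j * (s j * r i) * (x i * x i) ≈ N i j * (s i * s j) * ((r i * x i) * (r i * x i))
        half i j = begin-equality
          N i j * (s j * r i) * (x i * x i)          ≈⟨ *-congʳ (*-congˡ (*-congˡ (d*r≈r i))) ⟨
          N i j * (s j * (d i * r i)) * (x i * x i)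
            ≈⟨ solve 5 (λ a p q r x → a :* (q :* (p :* r :* r)) :* (x :* x) := a :* (p :* q) :* (r :* x :* (r :* x)))
                 refl (N i j) (s i) (s j) (r i) (x i) ⟩
          N i j * (s i * s j) * ((r i * x i) * (r i * x i)) ∎

        pointwise : ∀ i j → N i j * (x i * x j) + N j i * (x j * x i) ≤
          N i j * (s j * r i) * (x i * x i) + N j i * (s i * r j) * (x j * x j)
        pointwise i j = begin
          N i j * (x i * x j) + N j i * (x j * x i)
            ≈⟨ +-congˡ (*-cong (N-symmetric i j) (*-comm _ _)) ⟩
          N i j * (x i * x j) + N i j * (x i * x j)
            ≈⟨ +-cong (*-congʳ (N*dd≈N i j)) (*-congʳ (N*dd≈N i j)) ⟨
          N i j * (d i * d j) * (x i * x j) + N i j * (d i * d j) * (x i * x j)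
            ≈⟨ solve 7 (λ a p q r t x y →
                 a :* (p :* r :* (q :* t)) :* (x :* y) :+ a :* (p :* r :* (q :* t)) :* (x :* y)
                 := a :* (p :* q) :* (r :* x :* (t :* y) :+ r :* x :* (t :* y)))
                 refl (N i j) (s i) (s j) (r i) (r j) (x i) (x j) ⟩
          N i j * (s i * s j) * ((r i * x i) * (r j * x j) + (r i * x i) * (r j * x j))
            ≤⟨ *-monoˡ-≤ _ (*-nonneg (N-nonneg i j) (*-nonneg (0≤s i) (0≤s j))) (2xy≤x²+y² _ _) ⟩
          N i j * (s i * s j) * ((r i * x i) * (r i * x i) + (r j * x j) * (r j * x j))
            ≈⟨ distribˡ _ _ _ ⟩
          N i j * (s i * s j) * ((r i * x i) * (r i * x i)) + N i j * (s i * s j) * ((r j * x j) * (r j * x j))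
            ≈⟨ +-cong (sym (half i j)) (trans (*-congʳ (*-cong (sym (N-symmetric i j)) (*-comm _ _))) (sym (half j i))) ⟩
          N i j * (s j * r i) * (x i * x i) + N j i * (s i * r j) * (x j * x j) ∎

        psd : 0# ≤ bilinear cleared x x
        psd = begin
          0#                                              ≤⟨ proj₂ (proj₁ Z-dnn) (λ i → d i * x i) ⟩
          bilinear Z (λ i → d i * x i) (λ i → d i * x i)  ≈⟨ HK+N x ⟨
          ∑∑ (λ i j → H i j * K i j * (x i * x j)) + ∑∑ (λ i j → N i j * (x i * x j))
            ≤⟨ +-mono-≤ ≤-refl (symmetrize-≤ pointwise) ⟩
          ∑∑ (λ i j → H i j * K i j * (x i * x j)) + ∑∑ (λ i j → N i j * (s j * r i) * (x i * x i))
            ≈⟨ bilinear-cleared x ⟨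
          bilinear cleared x x ∎

    cleared-⊙Ā : cleared ⊙ Ā ≈ᴹ 𝟎
    cleared-⊙Ā i j = begin-equality
      (H i j * K i j + diagonal load i j) * Ā i j
        ≈⟨ solve 4 (λ h k e a → (h :* k :+ e) :* a := h :* a :* k :+ e :* a) refl (H i j) (K i j) (diagonal load i j) (Ā i j) ⟩
      H i j * Ā i j * K i j + diagonal load i j * Ā i j
        ≈⟨ +-cong (trans (*-congʳ (H*Ā≈0 i j)) (zeroˡ _)) diagonal*Ā≈0 ⟩
      0# + 0#
        ≈⟨ +-identityʳ _ ⟩
      0# ∎
      where
      diagonal*Ā≈0 : diagonal load i j * Ā i j ≈ 0#
      diagonal*Ā≈0 = case (i Fin.≟ j) of λ where
        (yes ≡.refl) → trans (*-congˡ (adjacency-diag (complement G) i)) (zeroʳ _)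
        (no i≢j)     → trans (*-congʳ (diagonal-off load i≢j)) (zeroˡ _)

    objective-cleared : objective cleared ≈ objective Z
    objective-cleared = begin-equality
      objective cleared    ≈⟨ ⟨outer,⟩ s cleared ⟩
      bilinear cleared s s ≈⟨ bilinear-cleared s ⟩
      ∑∑ (λ i j → H i j * K i j * (s i * s j)) + ∑∑ (λ i j → N i j * (s j * r i) * (s i * s i))
        ≈⟨ +-congˡ (∑∑-cong λ i j → trans
             (solve 4 (λ a p q r → a :* (q :* r) :* (p :* p) := a :* (p :* r :* p :* q)) refl (N i j) (s i) (s j) (r i))
             (*-congˡ (*-congʳ (d*s≈s i)))) ⟩
      ∑∑ (λ i j → H i j * K i j * (s i * s j)) + ∑∑ (λ i j → N i j * (s i * s j))
        ≈⟨ HK+N s ⟩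
      bilinear Z (λ i → d i * s i) (λ i → d i * s i)
        ≈⟨ ∑∑-cong (λ i j → *-cong (*-congʳ (d*s≈s i)) (d*s≈s j)) ⟩
      bilinear Z s s       ≈⟨ ⟨outer,⟩ s Z ⟨
      objective Z          ∎

    trace-cleared : trace cleared ≈ ⟨ M , Z ⟩
    trace-cleared = begin-equality
      ∑[ i < n ] (H i i * K i i + diagonal load i i)
        ≈⟨ sum-cong-≋ (λ i → +-cong (diagonal-term i) (diagonal-diag load i)) ⟩
      ∑[ i < n ] (r i * s i * Z i i + load i)
        ≈⟨ ∑-distrib-+ (λ i → r i * s i * Z i i) load ⟩
      ∑[ i < n ] (r i * s i * Z i i) + ∑∑ (λ i j → N i j * (s j * r i))
        ≈⟨ +-congˡ (∑∑-cong off-diagonal-term) ⟩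
      ∑[ i < n ] (r i * s i * Z i i) + ∑∑ (λ i j → Ā i j * (r i * s j * Z i j))
        ≈⟨ sum-I+Ā (λ i j → r i * s j * Z i j) ⟨
      ∑∑ (λ i j → I+Ā i j * (r i * s j * Z i j))
        ≈⟨ ⟨M,⟩ Z-symmetric ⟨
      ⟨ M , Z ⟩ ∎
      where
      diagonal-term : ∀ i → H i i * K i i ≈ r i * s i * Z i i
      diagonal-term i = begin-equality
        H i i * (d i * d i * Z i i)  ≈⟨ *-cong (H-diag i) (*-congʳ (d*d≈d i)) ⟩
        1# * (d i * Z i i)           ≈⟨ *-identityˡ _ ⟩
        s i * r i * Z i i            ≈⟨ *-congʳ (*-comm _ _) ⟩
        r i * s i * Z i i            ∎
      off-diagonal-term : ∀ i j → N i j * (s j * r i) ≈ Ā i j * (r i * s j * Z i j)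
      off-diagonal-term i j = begin-equality
        Ā i j * (d i * d j * Z i j) * (s j * r i)
          ≈⟨ solve 6 (λ a p q z s r → a :* (p :* q :* z) :* (s :* r) := a :* (p :* r :* (q :* s) :* z))
               refl (Ā i j) (d i) (d j) (Z i j) (s j) (r i) ⟩
        Ā i j * (d i * r i * (d j * s j) * Z i j)
          ≈⟨ *-congˡ (*-congʳ (*-cong (d*r≈r i) (d*s≈s j))) ⟩
        Ā i j * (r i * s j * Z i j) ∎

  DNN-bound : ∀ {v} →
    (∀ Z → Maximization.Feasible (definingProgram DoublyNonnegative G w) Z → objective Z ≤ v) →
    ∀ Z → DoublyNonnegative Z → objective Z ≤ v * ⟨ M , Z ⟩
  DNN-bound {v} bound Z Z-dnn with trace (cleared Z-dnn) ≟ 0#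
  ... | yes t≈0 = ≤-reflexive (begin-equality
    objective Z        ≈⟨ objective-cleared Z-dnn ⟨
    objective Z′       ≈⟨ sum-zero (λ i → sum-zero λ k → trans (*-congˡ (Z′≈0 k i)) (zeroʳ (outer s i k))) ⟩
    0#                 ≈⟨ zeroʳ v ⟨
    v * 0#             ≈⟨ *-congˡ (trans (sym t≈0) (trace-cleared Z-dnn)) ⟩
    v * ⟨ M , Z ⟩      ∎)
    where
    Z′ = cleared Z-dnn
    Z′≈0 : ∀ k i → Z′ k i ≈ 0#
    Z′≈0 k i = antisym (≤-respʳ-≈ t≈0 (DNN-entry≤trace (cleared-DNN Z-dnn) k i)) (proj₂ (cleared-DNN Z-dnn) k i)
  ... | no t≉0 = begin
    objective Z            ≈⟨ objective-cleared Z-dnn ⟨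
    objective Z′           ≈⟨ t*[t⁻¹*x]≈x (objective Z′) ⟨
    t * (t ⁻¹ * objective Z′)  ≈⟨ *-congˡ (⟨,⟩-scale (outer s) (t ⁻¹) Z′) ⟨
    t * objective Z″       ≤⟨ *-monoˡ-≤ t 0≤t (bound Z″ (⟨𝐈,Z″⟩≈1 , Z″⊙Ā≈0 , DNN-scale (t ⁻¹) (⁻¹-0≤ 0≤t) (cleared-DNN Z-dnn))) ⟩
    t * v                  ≈⟨ *-comm t v ⟩
    v * t                  ≈⟨ *-congˡ (trace-cleared Z-dnn) ⟩
    v * ⟨ M , Z ⟩          ∎
    where
    Z′ = cleared Z-dnn
    t = trace Z′
    Z″ = t ⁻¹ · Z′
    0≤t : 0# ≤ t
    0≤t = sum-nonneg λ i → proj₂ (cleared-DNN Z-dnn) i i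
    t*[t⁻¹*x]≈x : ∀ x → t * (t ⁻¹ * x) ≈ x
    t*[t⁻¹*x]≈x x = trans (sym (*-assoc _ _ _)) (trans (*-congʳ (⁻¹-inverseʳ t t≉0)) (*-identityˡ x))
    ⟨𝐈,Z″⟩≈1 : ⟨ 𝐈 , Z″ ⟩ ≈ 1#
    ⟨𝐈,Z″⟩≈1 = begin-equality
      ⟨ 𝐈 , Z″ ⟩         ≈⟨ ⟨,⟩-scale 𝐈 (t ⁻¹) Z′ ⟩
      t ⁻¹ * ⟨ 𝐈 , Z′ ⟩  ≈⟨ *-congˡ (⟨𝐈,⟩ Z′) ⟩
      t ⁻¹ * t           ≈⟨ *-comm _ _ ⟩
      t * t ⁻¹           ≈⟨ ⁻¹-inverseʳ t t≉0 ⟩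
      1#                 ∎
    Z″⊙Ā≈0 : Z″ ⊙ Ā ≈ᴹ 𝟎
    Z″⊙Ā≈0 i j = trans (*-assoc _ _ _) (trans (*-congˡ (cleared-⊙Ā Z-dnn i j)) (zeroʳ _))

module Compactness (em : ExcludedMiddle 0ℓ) (ℝ : CompleteOrderedField) where

  open OrderedSums ℝ
  open MatrixForms ℝ

  Positive : Carrier → Set
  Positive ε = 0# ≤ ε × ¬ ε ≈ 0#

  x+ε≰x : ∀ {x ε} → Positive ε → ¬ x + ε ≤ x
  x+ε≰x {x} {ε} (0≤ε , ε≉0) x+ε≤x = ε≉0 (antisym
    (+-cancelʳ-≤ x (≤-respˡ-≈ (+-comm x ε) (≤-respʳ-≈ (sym (+-identityˡ x)) x+ε≤x))) 0≤ε)

  1-positive : Positive 1#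
  1-positive = 0≤1 , 1≉0

  ≤-from-multiples : ∀ {x y} C → 0# ≤ C → (∀ ε → Positive ε → x ≤ y + C * ε) → x ≤ y
  ≤-from-multiples {x} {y} C 0≤C x≤y+Cε with total x y
  ... | inj₁ x≤y = x≤y
  ... | inj₂ y≤x with d , 0≤d , y+d≈x ← ≤⇒∃ y≤x | d ≟ 0#
  ...   | yes d≈0 = ≤-reflexive (trans (sym y+d≈x) (trans (+-congˡ d≈0) (+-identityʳ y)))
  ...   | no  d≉0 = contradiction (begin
          y + C * ε + ε  ≈⟨ trans (+-assoc y _ _) (+-congˡ Cε+ε≈d) ⟩
          y + d          ≈⟨ y+d≈x ⟩
          x              ≤⟨ x≤y+Cε ε ε-positive ⟩
          y + C * ε      ∎) (x+ε≰x ε-positive)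
    where
    ε = d * (C + 1#) ⁻¹
    Cε+ε≈d : C * ε + ε ≈ d
    Cε+ε≈d = begin-equality
      C * (d * (C + 1#) ⁻¹) + d * (C + 1#) ⁻¹
        ≈⟨ solve 3 (λ c d i → c :* (d :* i) :+ d :* i := (c :+ con 1) :* i :* d) refl C d ((C + 1#) ⁻¹) ⟩
      (C + 1#) * (C + 1#) ⁻¹ * d
        ≈⟨ trans (*-congʳ (⁻¹-inverseʳ (C + 1#) (0≤x⇒x+1≉0 0≤C))) (*-identityˡ d) ⟩
      d ∎
    ε-positive : Positive ε
    ε-positive = *-nonneg 0≤d (⁻¹-0≤ (+-nonneg 0≤C 0≤1)) , λ ε≈0 → d≉0 (begin-equality
      d            ≈⟨ Cε+ε≈d ⟨
      C * ε + ε    ≈⟨ +-cong (trans (*-congˡ ε≈0) (zeroʳ C)) ε≈0 ⟩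
      0# + 0#      ≈⟨ +-identityʳ 0# ⟩
      0#           ∎)

  sup-approximation : ∀ {P b} → b IsSupremumOf P → ∀ ε → Positive ε → ∃[ x ] P x × b ≤ x + ε
  sup-approximation {P} {b} (_ , least) ε ε>0 with em {∃[ x ] P x × b ≤ x + ε}
  ... | yes found = found
  ... | no  none  = contradiction (begin
    b + ε          ≤⟨ +-monoˡ-≤ ε (least (b + -1# * ε) upper) ⟩
    b + -1# * ε + ε
      ≈⟨ solve 3 (λ b m e → b :+ m :* e :+ e := b :+ (e :+ m :* e)) refl b -1# ε ⟩
    b + (ε + -1# * ε)  ≈⟨ +-congˡ (x+-1*x≈0 ε) ⟩
    b + 0#         ≈⟨ +-identityʳ b ⟩
    b              ∎) (x+ε≰x ε>0)
    where
    upper : (b + -1# * ε) IsUpperBoundOf P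
    upper x Px with total b (x + ε)
    ... | inj₁ b≤x+ε = contradiction (x , Px , b≤x+ε) none
    ... | inj₂ x+ε≤b = begin
      x                  ≈⟨ +-identityʳ x ⟨
      x + 0#             ≈⟨ +-congˡ (x+-1*x≈0 ε) ⟨
      x + (ε + -1# * ε)  ≈⟨ +-assoc x _ _ ⟨
      x + ε + -1# * ε    ≤⟨ +-monoˡ-≤ (-1# * ε) x+ε≤b ⟩
      b + -1# * ε        ∎

  Near : Carrier → Carrier → Carrier → Set
  Near ε x y = x ≤ y + ε × y ≤ x + ε

  Near-mono : ∀ {ε δ x y} → ε ≤ δ → Near ε x y → Near δ x y
  Near-mono ε≤δ (p , q) = ≤-trans p (+-mono-≤ ≤-refl ε≤δ) , ≤-trans q (+-mono-≤ ≤-refl ε≤δ)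

  -- P is a filter base, indexed by ε > 0 and shrinking with ε.
  module _ {X : Set} where

    cluster-value : (c : X → Carrier) (P : Carrier → X → Set) →
      (∀ {ε δ x} → ε ≤ δ → P ε x → P δ x) →
      (∀ ε → Positive ε → ∃ (P ε)) →
      (∀ {ε x} → P ε x → 0# ≤ c x × c x ≤ 1#) →
      ∃[ y ] (∀ ε → Positive ε → ∃[ x ] P ε x × Near ε (c x) y)
    cluster-value c P mono nonempty bounded = y , near
      where
      Frequent : Carrier → Set
      Frequent a = ∀ ε → Positive ε → ∃[ x ] P ε x × a ≤ c x
      sup : ∃ (_IsSupremumOf Frequent)
      sup = complete Frequent
        (0# , λ ε ε>0 → case nonempty ε ε>0 of λ (x , Px) → x , Px , proj₁ (bounded Px))
        (1# , λ a frequent → case frequent 1# 1-positive of λ (x , Px , a≤cx) →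
                ≤-trans a≤cx (proj₂ (bounded Px)))
      y = proj₁ sup
      near : ∀ ε → Positive ε → ∃[ x ] P ε x × Near ε (c x) y
      near ε ε>0 with em {∃[ δ ] Positive δ × ¬ (∃[ x ] P δ x × y + ε ≤ c x)}
      ... | no none = contradiction (proj₁ (proj₂ sup) (y + ε) frequent) (x+ε≰x ε>0)
        where
        frequent : Frequent (y + ε)
        frequent δ δ>0 = case em {∃[ x ] P δ x × y + ε ≤ c x} of λ where
          (yes found) → found
          (no ¬found) → contradiction (δ , δ>0 , ¬found) none
      ... | yes (δ , δ>0 , ¬above) = case total ε δ of λ where
          (inj₁ ε≤δ) → pick ε ε>0 ε≤δ ≤-refl
          (inj₂ δ≤ε) → pick δ δ>0 ≤-refl δ≤ε
        where
        pick : ∀ γ → Positive γ → γ ≤ δ → γ ≤ ε → ∃[ x ] P ε x × Near ε (c x) y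
        pick γ γ>0 γ≤δ γ≤ε
          with a , frequent , y≤a+ε ← sup-approximation (proj₂ sup) ε ε>0
          with x , Px , a≤cx ← frequent γ γ>0
          with total (c x) (y + ε)
        ... | inj₁ cx≤y+ε = x , mono γ≤ε Px , cx≤y+ε , ≤-trans y≤a+ε (+-monoˡ-≤ ε a≤cx)
        ... | inj₂ y+ε≤cx = contradiction (x , mono γ≤δ Px , y+ε≤cx) ¬above

    cluster-vector : ∀ {m} (c : Fin m → X → Carrier) (P : Carrier → X → Set) →
      (∀ {ε δ x} → ε ≤ δ → P ε x → P δ x) →
      (∀ ε → Positive ε → ∃ (P ε)) →
      (∀ {ε x} → P ε x → ∀ i → 0# ≤ c i x × c i x ≤ 1#) →
      Σ[ y ∈ Vector Carrier m ] (∀ ε → Positive ε → ∃[ x ] P ε x × (∀ i → Near ε (c i x) (y i)))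
    cluster-vector {ℕ.zero} c P mono nonempty bounded =
      (λ ()) , λ ε ε>0 → case nonempty ε ε>0 of λ (x , Px) → x , Px , λ ()
    cluster-vector {ℕ.suc m} c P mono nonempty bounded
      with y₀ , near₀ ← cluster-value (c zero) P mono nonempty (λ Px → bounded Px zero)
      with y , near ← cluster-vector (c ∘ suc) (λ ε x → P ε x × Near ε (c zero x) y₀)
             (λ ε≤δ (Px , x-near) → mono ε≤δ Px , Near-mono ε≤δ x-near)
             near₀
             (λ (Px , _) i → bounded Px (suc i))
      = (λ { zero → y₀ ; (suc i) → y i }) , λ ε ε>0 → case near ε ε>0 of λ where
          (x , (Px , x-near) , x-nears) → x , Px , λ { zero → x-near ; (suc i) → x-nears i }

  cluster-matrix : ∀ {n} (P : Carrier → Matrix n → Set) →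
    (∀ {ε δ Z} → ε ≤ δ → P ε Z → P δ Z) →
    (∀ ε → Positive ε → ∃ (P ε)) →
    (∀ {ε Z} → P ε Z → ∀ i j → 0# ≤ Z i j × Z i j ≤ 1#) →
    Σ[ Y ∈ Matrix n ] (∀ ε → Positive ε → ∃[ Z ] P ε Z × (∀ i j → Near ε (Z i j) (Y i j)))
  cluster-matrix {n} P mono nonempty bounded
    with y , near ← cluster-vector (λ k Z → uncurry Z (remQuot n k)) P mono nonempty (λ PZ k → uncurry (bounded PZ) (remQuot n k))
    = (λ i j → y (combine i j)) , λ ε ε>0 → case near ε ε>0 of λ (Z , PZ , Z-near) →
        Z , PZ , λ i j → ≡.subst (λ ij → Near ε (uncurry Z ij) (y (combine i j))) (Fin.remQuot-combine i j) (Z-near (combine i j))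

  Lipschitz : ∀ {n} → (Matrix n → Carrier) → Set
  Lipschitz L = ∃[ C ] 0# ≤ C × (∀ {ε Y Z} → Positive ε → (∀ i j → Near ε (Y i j) (Z i j)) → L Y ≤ L Z + C * ε)

  Near-sym : ∀ {ε x y} → Near ε x y → Near ε y x
  Near-sym (p , q) = q , p

  lip-entry : ∀ {n} (i j : Fin n) → Lipschitz (λ Z → Z i j)
  lip-entry i j = 1# , 0≤1 , λ {ε} _ near → ≤-respʳ-≈ (+-congˡ (sym (*-identityˡ ε))) (proj₁ (near i j))

  lip-const : ∀ {n} c → Lipschitz {n} (λ _ → c)
  lip-const c = 0# , ≤-refl , λ {ε} _ _ → ≤-reflexive (sym (trans (+-congˡ (zeroˡ ε)) (+-identityʳ c)))

  lip-+ : ∀ {n} {L L′ : Matrix n → Carrier} → Lipschitz L → Lipschitz L′ → Lipschitz (λ Z → L Z + L′ Z)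
  lip-+ (C , 0≤C , l) (C′ , 0≤C′ , l′) = C + C′ , +-nonneg 0≤C 0≤C′ , λ {ε} ε>0 near →
    ≤-respʳ-≈ (solve 5 (λ a b c c′ e → (a :+ c :* e) :+ (b :+ c′ :* e) := a :+ b :+ (c :+ c′) :* e) refl _ _ C C′ ε)
      (+-mono-≤ (l ε>0 near) (l′ ε>0 near))

  lip-sum : ∀ {n m} {L : Fin m → Matrix n → Carrier} → (∀ l → Lipschitz (L l)) → Lipschitz (λ Z → sum (λ l → L l Z))
  lip-sum {m = ℕ.zero}  _   = lip-const 0#
  lip-sum {m = ℕ.suc m} lip = lip-+ (lip zero) (lip-sum (lip ∘ suc))

  lip-cong : ∀ {n} {L L′ : Matrix n → Carrier} → (∀ Z → L Z ≈ L′ Z) → Lipschitz L → Lipschitz L′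
  lip-cong L≈L′ (C , 0≤C , l) = C , 0≤C , λ {_} {Y} {Z} ε>0 near →
    ≤-respˡ-≈ (L≈L′ Y) (≤-respʳ-≈ (+-congʳ (L≈L′ Z)) (l ε>0 near))

  lip-* : ∀ {n} {L : Matrix n → Carrier} c → Lipschitz L → Lipschitz (λ Z → c * L Z)
  lip-* {L = L} c (C , 0≤C , l) with total 0# c
  ... | inj₁ 0≤c = c * C , *-nonneg 0≤c 0≤C , λ {ε} {Y} {Z} ε>0 near → begin
    c * L Y              ≤⟨ *-monoˡ-≤ c 0≤c (l ε>0 near) ⟩
    c * (L Z + C * ε)    ≈⟨ solve 4 (λ c z k e → c :* (z :+ k :* e) := c :* z :+ c :* k :* e) refl c (L Z) C ε ⟩
    c * L Z + c * C * ε  ∎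
  ... | inj₂ c≤0 with b , 0≤b , c+b≈0 ← ≤⇒∃ c≤0 = b * C , *-nonneg 0≤b 0≤C , λ {ε} {Y} {Z} ε>0 near →
    +-cancelʳ-≤ (b * L Y + b * L Z) (begin
      c * L Y + (b * L Y + b * L Z)
        ≈⟨ solve 4 (λ c b y z → c :* y :+ (b :* y :+ b :* z) := (c :+ b) :* y :+ b :* z) refl c b (L Y) (L Z) ⟩
      (c + b) * L Y + b * L Z
        ≈⟨ trans (+-congʳ (trans (*-congʳ c+b≈0) (zeroˡ _))) (+-identityˡ _) ⟩
      b * L Z
        ≤⟨ *-monoˡ-≤ b 0≤b (l ε>0 λ i j → Near-sym (near i j)) ⟩
      b * (L Y + C * ε)
        ≈⟨ trans (+-congˡ (trans (*-congʳ c+b≈0) (zeroˡ (L Z)))) (+-identityʳ _) ⟨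
      b * (L Y + C * ε) + (c + b) * L Z
        ≈⟨ solve 6 (λ c b y z k e → b :* (y :+ k :* e) :+ (c :+ b) :* z := c :* z :+ b :* k :* e :+ (b :* y :+ b :* z))
             refl c b (L Y) (L Z) C ε ⟩
      c * L Z + b * C * ε + (b * L Y + b * L Z) ∎)

  lip-*ʳ : ∀ {n} {L : Matrix n → Carrier} c → Lipschitz L → Lipschitz (λ Z → L Z * c)
  lip-*ʳ c lip = lip-cong (λ _ → *-comm c _) (lip-* c lip)

  closed : ∀ {n} {L L′ : Matrix n → Carrier} (Y : Matrix n) → Lipschitz L → Lipschitz L′ →
    (∀ ε → Positive ε → ∃[ Z ] L Z ≤ L′ Z + ε × (∀ i j → Near ε (Z i j) (Y i j))) → L Y ≤ L′ Y
  closed {L = L} {L′} Y (C , 0≤C , l) (C′ , 0≤C′ , l′) approx =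
    ≤-from-multiples (C + C′ + 1#) (+-nonneg (+-nonneg 0≤C 0≤C′) 0≤1) λ ε ε>0 →
      case approx ε ε>0 of λ (Z , LZ≤L′Z+ε , near) → begin
        L Y                             ≤⟨ l ε>0 (λ i j → Near-sym (near i j)) ⟩
        L Z + C * ε                     ≤⟨ +-monoˡ-≤ _ LZ≤L′Z+ε ⟩
        L′ Z + ε + C * ε                ≤⟨ +-monoˡ-≤ _ (+-monoˡ-≤ ε (l′ ε>0 near)) ⟩
        L′ Y + C′ * ε + ε + C * ε
          ≈⟨ solve 4 (λ y k k′ e → y :+ k′ :* e :+ e :+ k :* e := y :+ (k :+ k′ :+ con 1) :* e) refl (L′ Y) C C′ ε ⟩
        L′ Y + (C + C′ + 1#) * ε        ∎

  lip-⟨,⟩ : ∀ {n} (A : Matrix n) → Lipschitz ⟨ A ,_⟩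
  lip-⟨,⟩ A = lip-sum λ i → lip-sum λ k → lip-* (A i k) (lip-entry k i)

  lip-bilinear : ∀ {n} (x y : Vector Carrier n) → Lipschitz (λ Z → bilinear Z x y)
  lip-bilinear x y = lip-sum λ i → lip-sum λ j → lip-*ʳ (y j) (lip-* (x i) (lip-entry i j))

  module _ {n : ℕ} (G : Graph n) (w : Vector Carrier n) where

    open Weighting ℝ G w
    open Maximization (definingProgram DoublyNonnegative G w) using (Feasible)

    DNN-maximum : ∃ Feasible → ∃ (_IsMaximumOf definingProgram DoublyNonnegative G w)
    DNN-maximum (Z₀ , feasible₀) = v , (Y , Y-feasible , objective-Y) , bound
      where
      Value : Carrier → Set
      Value t = ∃[ Z ] Feasible Z × objective Z ≈ t

      entry≤1 : ∀ {Z} → Feasible Z → ∀ i j → Z i j ≤ 1#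
      entry≤1 {Z} (tr≈1 , _ , dnn) i j =
        ≤-respʳ-≈ (trans (sym (⟨𝐈,⟩ Z)) tr≈1) (DNN-entry≤trace dnn i j)

      value≤ : (∑∑ λ i k → outer s i k * 1#) IsUpperBoundOf Value
      value≤ t (Z , feasible , obj≈t) = ≤-respˡ-≈ obj≈t (∑∑-mono-≤ λ i k →
        *-monoˡ-≤ (outer s i k) (*-nonneg (0≤s i) (0≤s k)) (entry≤1 feasible k i))

      sup : ∃ (_IsSupremumOf Value)
      sup = complete Value (objective Z₀ , Z₀ , feasible₀ , refl) (_ , value≤)

      v = proj₁ sup

      bound : ∀ Z → Feasible Z → objective Z ≤ v
      bound Z feasible = proj₁ (proj₂ sup) _ (Z , feasible , refl)

      Approximate : Carrier → Matrix n → Set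
      Approximate ε Z = Feasible Z × v ≤ objective Z + ε

      approximate : ∀ ε → Positive ε → ∃ (Approximate ε)
      approximate ε ε>0 = case sup-approximation (proj₂ sup) ε ε>0 of λ where
        (t , (Z , feasible , obj≈t) , v≤t+ε) → Z , feasible , ≤-respʳ-≈ (+-congʳ (sym obj≈t)) v≤t+ε

      limit = cluster-matrix Approximate
        (λ ε≤δ (feasible , v≤) → feasible , ≤-trans v≤ (+-mono-≤ ≤-refl ε≤δ))
        approximate
        (λ (feasible@(_ , _ , dnn) , _) i j → proj₂ dnn i j , entry≤1 feasible i j)

      Y = proj₁ limit

      near-Y : ∀ {L L′} → Lipschitz L → Lipschitz L′ →
               (∀ {ε Z} → 0# ≤ ε → Approximate ε Z → L Z ≤ L′ Z + ε) → L Y ≤ L′ Y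
      near-Y lip lip′ L≤L′ = closed Y lip lip′ λ ε ε>0 → case proj₂ limit ε ε>0 of λ (Z , approx , near) →
        Z , L≤L′ (proj₁ ε>0) approx , near

      inherit-≤ : ∀ {L L′} → Lipschitz L → Lipschitz L′ → (∀ {Z} → Feasible Z → L Z ≤ L′ Z) → L Y ≤ L′ Y
      inherit-≤ lip lip′ L≤L′ = near-Y lip lip′ λ 0≤ε (feasible , _) → ≤-trans (L≤L′ feasible) (x≤x+y 0≤ε)

      inherit-≈ : ∀ {L L′} → Lipschitz L → Lipschitz L′ → (∀ {Z} → Feasible Z → L Z ≈ L′ Z) → L Y ≈ L′ Y
      inherit-≈ lip lip′ L≈L′ = antisym
        (inherit-≤ lip lip′ (≤-reflexive ∘ L≈L′)) (inherit-≤ lip′ lip (≤-reflexive ∘ sym ∘ L≈L′))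

      Y-feasible : Feasible Y
      Y-feasible =
        inherit-≈ (lip-⟨,⟩ 𝐈) (lip-const 1#) proj₁ ,
        (λ i j → inherit-≈ (lip-*ʳ (Ā i j) (lip-entry i j)) (lip-const 0#) λ (_ , Z⊙Ā≈0 , _) → Z⊙Ā≈0 i j) ,
        ((λ i j → inherit-≈ (lip-entry j i) (lip-entry i j) λ (_ , _ , (Z-sym , _) , _) → Z-sym i j) ,
         (λ x → inherit-≤ (lip-const 0#) (lip-bilinear x x) λ (_ , _ , (_ , Z-psd) , _) → Z-psd x)) ,
        (λ i j → inherit-≤ (lip-const 0#) (lip-entry i j) λ (_ , _ , _ , 0≤Z) → 0≤Z i j)

      objective-Y : objective Y ≈ v
      objective-Y = antisym (bound Y Y-feasible) (near-Y (lip-const v) (lip-⟨,⟩ (outer s)) λ _ → proj₂)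

module Shifting (ℝ : CompleteOrderedField) {n : ℕ} (G : Graph n) (p : Vector (CompleteOrderedField.Carrier ℝ) n) where

  open OrderedSums ℝ
  open MatrixForms ℝ

  Ā A : Matrix n
  Ā = adjacency (complement G)
  A i j = p i * (𝐈 ⊕ Ā) i j

  form : Vector Carrier n → Carrier
  form y = bilinear A y y

  record _↘_ (y y′ : Vector Carrier n) : Set where
    field
      nonneg    : NonNegative y′
      same-sum  : sum y′ ≈ sum y
      form-≤    : form y′ ≤ form y
      vanishing : ∀ {k} → y k ≈ 0# → y′ k ≈ 0#

  open _↘_ public

  ↘-refl : ∀ {y} → NonNegative y → y ↘ y
  ↘-refl 0≤y = record { nonneg = 0≤y ; same-sum = refl ; form-≤ = ≤-refl ; vanishing = λ y≈0 → y≈0 }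

  ↘-trans : ∀ {x y z} → x ↘ y → y ↘ z → x ↘ z
  ↘-trans x↘y y↘z = record
    { nonneg    = nonneg y↘z
    ; same-sum  = trans (same-sum y↘z) (same-sum x↘y)
    ; form-≤    = ≤-trans (form-≤ y↘z) (form-≤ x↘y)
    ; vanishing = λ {k} → vanishing y↘z {k} ∘ vanishing x↘y {k}
    }

  Separates : Vector Carrier n → Fin n → Fin n → Set
  Separates y i j = Graph.Adjacent (complement G) i j → y i ≈ 0# ⊎ y j ≈ 0#

  A-diag : ∀ i → A i i ≈ p i
  A-diag i = trans (*-congˡ (trans (+-cong (diagonal-diag (λ _ → 1#) i) (adjacency-diag (complement G) i)) (+-identityʳ 1#)))
                   (*-identityʳ _)

  A-off : ∀ {i j} → Graph.Adjacent (complement G) i j → A i j ≈ p i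
  A-off {i} {j} ij@(i≢j , _) = trans (*-congˡ (trans (+-cong (diagonal-off (λ _ → 1#) i≢j) Āij≈1) (+-identityˡ 1#)))
                                     (*-identityʳ _)
    where
    Āij≈1 : Ā i j ≈ 1#
    Āij≈1 = case adjacency-cases (complement G) i j of λ where
      (inj₁ (_ , q))   → q
      (inj₂ (¬ij , _)) → contradiction ij ¬ij

  form-difference : ∀ {i j} → Graph.Adjacent (complement G) i j → form (difference i j) ≈ 0#
  form-difference {i} {j} ij = antisym
    (+-cancelʳ-≤ (A i j + A j i) (≤-reflexive eq)) (+-cancelʳ-≤ (A i j + A j i) (≤-reflexive (sym eq)))
    where
    eq : form (difference i j) + (A i j + A j i) ≈ 0# + (A i j + A j i)
    eq = begin-equality
      form (difference i j) + (A i j + A j i)  ≈⟨ bilinear-difference A i j ⟩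
      A i i + A j j  ≈⟨ +-cong (trans (A-diag i) (sym (A-off ij)))
                               (trans (A-diag j) (sym (A-off (Graph.symmetric (complement G) ij)))) ⟩
      A i j + A j i  ≈⟨ +-identityˡ _ ⟨
      0# + (A i j + A j i) ∎

  slope : Vector Carrier n → Vector Carrier n → Carrier
  slope y u = bilinear A y u + bilinear A u y

  slope-swap : ∀ y i j → slope y (difference j i) ≈ -1# * slope y (difference i j)
  slope-swap y i j = begin-equality
    slope y (difference j i)
      ≈⟨ +-cong (bilinear-congʳ A y swap) (bilinear-congˡ A y swap) ⟩
    slope y (λ k → -1# * difference i j k)
      ≈⟨ +-cong (bilinear-scaleʳ A -1# y (difference i j)) (bilinear-scaleˡ A -1# (difference i j) y) ⟩
    -1# * bilinear A y (difference i j) + -1# * bilinear A (difference i j) y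
      ≈⟨ distribˡ -1# _ _ ⟨
    -1# * slope y (difference i j) ∎
    where
    swap : ∀ k → difference j i k ≈ -1# * difference i j k
    swap k = begin-equality
      basis j k + -1# * basis i k                  ≈⟨ +-congʳ (trans (*-congʳ -1*-1≈1) (*-identityˡ _)) ⟨
      -1# * -1# * basis j k + -1# * basis i k
        ≈⟨ solve 3 (λ m a b → m :* m :* b :+ m :* a := m :* (a :+ m :* b)) refl -1# (basis i k) (basis j k) ⟩
      -1# * (basis i k + -1# * basis j k)          ∎

  sum-basis : ∀ (i : Fin n) → sum (basis i) ≈ 1#
  sum-basis i = trans (sum-single i λ k → diagonal-off (λ _ → 1#)) (diagonal-diag (λ _ → 1#) i)

  sum-difference : ∀ i j → sum (difference i j) ≈ 0#
  sum-difference i j = begin-equality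
    sum (difference i j)                       ≈⟨ ∑-distrib-+ (basis i) (λ k → -1# * basis j k) ⟩
    sum (basis i) + sum (λ k → -1# * basis j k)
      ≈⟨ +-cong (sum-basis i) (trans (sym (*-distribˡ-sum -1# (basis j))) (*-congˡ (sum-basis j))) ⟩
    1# + -1# * 1#                              ≈⟨ x+-1*x≈0 1# ⟩
    0#                                         ∎

  -- Along eᵢ − eⱼ the form is affine, so moving all of the mass of j to i
  -- does not increase it if the slope is nonpositive.
  move : ∀ {y i j} → NonNegative y → Graph.Adjacent (complement G) i j → ¬ y i ≈ 0# →
         slope y (difference i j) ≤ 0# → ∃[ y′ ] y ↘ y′ × y′ j ≈ 0#
  move {y} {i} {j} 0≤y ij@(i≢j , _) yᵢ≉0 slope≤0 = y′ , record
    { nonneg    = nonneg′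
    ; same-sum  = begin-equality
        sum y′                                        ≈⟨ ∑-distrib-+ y (λ k → y j * difference i j k) ⟩
        sum y + sum (λ k → y j * difference i j k)    ≈⟨ +-congˡ (*-distribˡ-sum (y j) (difference i j)) ⟨
        sum y + y j * sum (difference i j)            ≈⟨ +-congˡ (trans (*-congˡ (sum-difference i j)) (zeroʳ _)) ⟩
        sum y + 0#                                    ≈⟨ +-identityʳ _ ⟩
        sum y                                         ∎
    ; form-≤    = begin
        form y′
          ≈⟨ bilinear-line A y (difference i j) (y j) ⟩
        form y + y j * slope y (difference i j) + y j * y j * form (difference i j)
          ≈⟨ +-congˡ (trans (*-congˡ (form-difference ij)) (zeroʳ _)) ⟩
        form y + y j * slope y (difference i j) + 0#
          ≤⟨ +-monoˡ-≤ 0# (+-mono-≤ ≤-refl (*-monoˡ-≤ (y j) (0≤y j) slope≤0)) ⟩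
        form y + y j * 0# + 0#
          ≈⟨ solve 2 (λ f t → f :+ t :* con 0 :+ con 0 := f) refl (form y) (y j) ⟩
        form y ∎
    ; vanishing = vanishing′
    } , y′ⱼ≈0
    where
    y′ : Vector Carrier n
    y′ k = y k + y j * difference i j k

    y′ⱼ≈0 : y′ j ≈ 0#
    y′ⱼ≈0 = begin-equality
      y j + y j * (basis i j + -1# * basis j j)
        ≈⟨ +-congˡ (*-congˡ (+-cong (diagonal-off (λ _ → 1#) i≢j) (*-congˡ (diagonal-diag (λ _ → 1#) j)))) ⟩
      y j + y j * (0# + -1# * 1#)
        ≈⟨ solve 2 (λ t m → t :+ t :* (con 0 :+ m :* con 1) := t :+ m :* t) refl (y j) -1# ⟩
      y j + -1# * y j
        ≈⟨ x+-1*x≈0 (y j) ⟩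
      0# ∎

    y′-away : ∀ {k} → j ≢ k → y′ k ≈ y k + y j * basis i k
    y′-away {k} j≢k = +-congˡ (*-congˡ
      (trans (+-congˡ (trans (*-congˡ (diagonal-off (λ _ → 1#) j≢k)) (zeroʳ _))) (+-identityʳ _)))

    nonneg′ : NonNegative y′
    nonneg′ k = case (j Fin.≟ k) of λ where
      (yes ≡.refl) → ≤-reflexive (sym y′ⱼ≈0)
      (no j≢k)     → ≤-respʳ-≈ (sym (y′-away j≢k)) (+-nonneg (0≤y k) (*-nonneg (0≤y j) (basis-nonneg i k)))

    vanishing′ : ∀ {k} → y k ≈ 0# → y′ k ≈ 0#
    vanishing′ {k} yₖ≈0 = case (j Fin.≟ k) of λ where
      (yes ≡.refl) → y′ⱼ≈0
      (no j≢k)     → case basis-cases i k of λ where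
        (inj₁ (≡.refl , _)) → contradiction yₖ≈0 yᵢ≉0
        (inj₂ basis≈0)      → trans (y′-away j≢k)
          (trans (+-cong yₖ≈0 (trans (*-congˡ basis≈0) (zeroʳ _))) (+-identityʳ _))

  separate : ∀ {y} → NonNegative y → ∀ i j → ∃[ y′ ] y ↘ y′ × Separates y′ i j
  separate {y} 0≤y i j with Graph.adjacent? (complement G) i j | y i ≟ 0# | y j ≟ 0#
  ... | no ¬ij | _        | _        = y , ↘-refl 0≤y , λ ij → contradiction ij ¬ij
  ... | yes ij | yes yᵢ≈0 | _        = y , ↘-refl 0≤y , λ _ → inj₁ yᵢ≈0
  ... | yes ij | no _     | yes yⱼ≈0 = y , ↘-refl 0≤y , λ _ → inj₂ yⱼ≈0
  ... | yes ij | no yᵢ≉0  | no yⱼ≉0 with total (slope y (difference i j)) 0#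
  ...   | inj₁ slope≤0 = case move 0≤y ij yᵢ≉0 slope≤0 of λ (y′ , y↘y′ , y′ⱼ≈0) → y′ , y↘y′ , λ _ → inj₂ y′ⱼ≈0
  ...   | inj₂ 0≤slope = case move 0≤y (Graph.symmetric (complement G) ij) yⱼ≉0 swapped≤0 of
            λ (y′ , y↘y′ , y′ᵢ≈0) → y′ , y↘y′ , λ _ → inj₁ y′ᵢ≈0
    where
    swapped≤0 : slope y (difference j i) ≤ 0#
    swapped≤0 = ∃⇒≤ _ 0≤slope (trans (+-comm _ _) (trans (+-congˡ (slope-swap y i j)) (x+-1*x≈0 _)))

  separate-pairs : ∀ (ps : List (Fin n × Fin n)) {y} → NonNegative y →
                   ∃[ y′ ] y ↘ y′ × All (uncurry (Separates y′)) ps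
  separate-pairs []             0≤y = _ , ↘-refl 0≤y , []
  separate-pairs ((i , j) ∷ ps) 0≤y
    with y₁ , y↘y₁ , separated ← separate-pairs ps 0≤y
    with y₂ , y₁↘y₂ , separates ← separate (nonneg y↘y₁) i j
    = y₂ , ↘-trans y↘y₁ y₁↘y₂ , separates ∷ All.map keep separated
    where
    keep : ∀ {(i , j) : Fin n × Fin n} → Separates y₁ i j → Separates y₂ i j
    keep {i , j} sep ij = case sep ij of λ where
      (inj₁ q) → inj₁ (vanishing y₁↘y₂ {i} q)
      (inj₂ q) → inj₂ (vanishing y₁↘y₂ {j} q)

  separate-all : ∀ {y} → NonNegative y → ∃[ y′ ] y ↘ y′ × (∀ i j → Separates y′ i j)
  separate-all 0≤y =
    case separate-pairs (cartesianProduct (allFin n) (allFin n)) 0≤y of λ (y′ , y↘y′ , separated) →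
      y′ , y↘y′ , λ i j → All.lookup separated (∈-cartesianProduct⁺ (∈-allFin i) (∈-allFin j))

module WeightedCliques (em : ExcludedMiddle 0ℓ) (ℝ : CompleteOrderedField) {n : ℕ} (G : Graph n)
  (w : Vector (CompleteOrderedField.Carrier ℝ) n) (0≤w : ConicPrograms.NonNegative ℝ w) where

  open OrderedSums ℝ
  open MatrixForms ℝ
  open Weighting ℝ G w
  open Shifting ℝ G (λ i → r i * r i) using (form; separate-all; Separates; _↘_; nonneg; same-sum; form-≤; vanishing)

  maximum : ∀ {m} (P : Vec Bool m → Set) (f : Vec Bool m → Carrier) → ∃ P →
            ∃[ b ] P b × (∀ b′ → P b′ → f b′ ≤ f b)
  maximum {ℕ.zero}  P f ([] , P[]) = [] , P[] , λ { [] _ → ≤-refl }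
  maximum {ℕ.suc m} P f (x ∷ b , Pxb)
    with em {∃ (P ∘ (true ∷_))} | em {∃ (P ∘ (false ∷_))}
  ... | yes some₁ | no none₂
    with b₁ , Pb₁ , max₁ ← maximum (P ∘ (true ∷_)) (f ∘ (true ∷_)) some₁
    = true ∷ b₁ , Pb₁ , λ { (true ∷ b′) → max₁ b′ ; (false ∷ b′) Pb′ → contradiction (b′ , Pb′) none₂ }
  ... | no none₁ | yes some₂
    with b₂ , Pb₂ , max₂ ← maximum (P ∘ (false ∷_)) (f ∘ (false ∷_)) some₂
    = false ∷ b₂ , Pb₂ , λ { (true ∷ b′) Pb′ → contradiction (b′ , Pb′) none₁ ; (false ∷ b′) → max₂ b′ }
  ... | yes some₁ | yes some₂
    with b₁ , Pb₁ , max₁ ← maximum (P ∘ (true ∷_)) (f ∘ (true ∷_)) some₁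
    with b₂ , Pb₂ , max₂ ← maximum (P ∘ (false ∷_)) (f ∘ (false ∷_)) some₂
    with total (f (true ∷ b₁)) (f (false ∷ b₂))
  ...   | inj₁ 1≤2 = false ∷ b₂ , Pb₂ , λ { (true ∷ b′) Pb′ → ≤-trans (max₁ b′ Pb′) 1≤2 ; (false ∷ b′) → max₂ b′ }
  ...   | inj₂ 2≤1 = true ∷ b₁ , Pb₁ , λ { (true ∷ b′) → max₁ b′ ; (false ∷ b′) Pb′ → ≤-trans (max₂ b′ Pb′) 2≤1 }
  maximum {ℕ.suc m} P f (true  ∷ b , Pxb) | no none₁ | no none₂ = contradiction (b , Pxb) none₁
  maximum {ℕ.suc m} P f (false ∷ b , Pxb) | no none₁ | no none₂ = contradiction (b , Pxb) none₂

  mask : Vec Bool n → Vector Carrier n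
  mask b i = if lookup b i then 1# else 0#

  mask-cases : ∀ b i → lookup b i ≡ true × mask b i ≈ 1# ⊎ mask b i ≈ 0#
  mask-cases b i with lookup b i
  ... | true  = inj₁ (≡.refl , refl)
  ... | false = inj₂ refl

  mask*mask≈mask : ∀ b i → mask b i * mask b i ≈ mask b i
  mask*mask≈mask b i with mask-cases b i
  ... | inj₁ (_ , q) = trans (*-congˡ q) (*-identityʳ _)
  ... | inj₂ q       = trans (*-congˡ q) (trans (zeroʳ _) (sym q))

  mask-nonneg : ∀ b → NonNegative (mask b)
  mask-nonneg b i with mask-cases b i
  ... | inj₁ (_ , q) = ≤-respʳ-≈ (sym q) 0≤1
  ... | inj₂ q       = ≤-reflexive (sym q)

  IsClique : Vec Bool n → Set
  IsClique b = ∀ i j → lookup b i ≡ true → lookup b j ≡ true → ¬ Graph.Adjacent (complement G) i j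

  weight : Vec Bool n → Carrier
  weight b = ∑[ i < n ] (mask b i * w i)

  weight-nonneg : ∀ b → 0# ≤ weight b
  weight-nonneg b = sum-nonneg λ i → *-nonneg (mask-nonneg b i) (0≤w i)

  s*s≈w : ∀ i → s i * s i ≈ w i
  s*s≈w i = √-square (w i) (0≤w i)

  ∑[mask*s]²≈weight : ∀ b → sum (λ i → (mask b i * s i) * (mask b i * s i)) ≈ weight b
  ∑[mask*s]²≈weight b = sum-cong-≋ λ i → begin-equality
    (mask b i * s i) * (mask b i * s i)
      ≈⟨ solve 2 (λ m s → m :* s :* (m :* s) := m :* m :* (s :* s)) refl (mask b i) (s i) ⟩
    mask b i * mask b i * (s i * s i)
      ≈⟨ *-cong (mask*mask≈mask b i) (s*s≈w i) ⟩
    mask b i * w i ∎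

  separated-bound : ∀ {v} → (∀ b → IsClique b → weight b ≤ v) →
    ∀ {y} → (∀ {i} → s i ≈ 0# → y i ≈ 0#) → (∀ i j → Separates y i j) → sum y * sum y ≤ v * form y
  separated-bound {v} bound {y} y-supported separates = begin
    sum y * sum y
      ≈⟨ *-cong (sum-cong-≋ y≈a*b) (sum-cong-≋ y≈a*b) ⟩
    sum (λ i → a i * b i) * sum (λ i → a i * b i)
      ≤⟨ cauchy-schwarz a b ⟩
    sum (λ i → a i * a i) * sum (λ i → b i * b i)
      ≈⟨ *-cong (∑[mask*s]²≈weight support) ∑b²≈form ⟩
    weight support * form y
      ≤⟨ *-monoʳ-≤ (form y) (≤-respʳ-≈ ∑b²≈form (sum-nonneg λ i → square-nonneg (b i))) (bound support support-clique) ⟩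
    v * form y ∎
    where
    support : Vec Bool n
    support = tabulate λ i → not (does (y i ≟ 0#))

    a b : Vector Carrier n
    a i = mask support i * s i
    b i = r i * y i

    support⇒y≉0 : ∀ {i} → lookup support i ≡ true → ¬ y i ≈ 0#
    support⇒y≉0 {i} i∈ rewrite lookup∘tabulate (λ i → not (does (y i ≟ 0#))) i with y i ≟ 0#
    ... | no yᵢ≉0 = yᵢ≉0

    support-clique : IsClique support
    support-clique i j i∈ j∈ ij = case separates i j ij of λ where
      (inj₁ yᵢ≈0) → support⇒y≉0 i∈ yᵢ≈0
      (inj₂ yⱼ≈0) → support⇒y≉0 j∈ yⱼ≈0

    y≉0⇒mask≈1 : ∀ {i} → ¬ y i ≈ 0# → mask support i ≈ 1#
    y≉0⇒mask≈1 {i} yᵢ≉0 rewrite lookup∘tabulate (λ i → not (does (y i ≟ 0#))) i with y i ≟ 0#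
    ... | yes yᵢ≈0 = contradiction yᵢ≈0 yᵢ≉0
    ... | no _     = refl

    y≈a*b : ∀ i → y i ≈ a i * b i
    y≈a*b i = case (y i ≟ 0#) of λ where
      (yes yᵢ≈0) → trans yᵢ≈0 (sym (trans (*-congˡ (trans (*-congˡ yᵢ≈0) (zeroʳ _))) (zeroʳ _)))
      (no yᵢ≉0)  → sym (begin-equality
        mask support i * s i * (r i * y i)  ≈⟨ *-congʳ (trans (*-congʳ (y≉0⇒mask≈1 yᵢ≉0)) (*-identityˡ _)) ⟩
        s i * (r i * y i)                   ≈⟨ *-assoc _ _ _ ⟨
        s i * r i * y i                     ≈⟨ *-congʳ (⁻¹-inverseʳ (s i) (yᵢ≉0 ∘ y-supported)) ⟩
        1# * y i                            ≈⟨ *-identityˡ _ ⟩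
        y i                                 ∎)

    product≈0 : ∀ {i j} → y i ≈ 0# ⊎ y j ≈ 0# → y i * y j ≈ 0#
    product≈0 (inj₁ q) = trans (*-congʳ q) (zeroˡ _)
    product≈0 (inj₂ q) = trans (*-congˡ q) (zeroʳ _)

    Ā-term≈0 : ∀ i j → Ā i j * (r i * r i * (y i * y j)) ≈ 0#
    Ā-term≈0 i j = case adjacency-cases (complement G) i j of λ where
      (inj₂ (_ , Ā≈0)) → trans (*-congʳ Ā≈0) (zeroˡ _)
      (inj₁ (ij , _))  → trans (*-congˡ (trans (*-congˡ (product≈0 (separates i j ij))) (zeroʳ _))) (zeroʳ _)

    ∑b²≈form : sum (λ i → b i * b i) ≈ form y
    ∑b²≈form = sym (begin-equality
      form y
        ≈⟨ ∑∑-cong (λ i j → solve 4 (λ x p m z → x :* (p :* m) :* z := m :* (p :* (x :* z))) refl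
             (y i) (r i * r i) (I+Ā i j) (y j)) ⟩
      ∑∑ (λ i j → I+Ā i j * (r i * r i * (y i * y j)))
        ≈⟨ sum-I+Ā (λ i j → r i * r i * (y i * y j)) ⟩
      sum (λ i → r i * r i * (y i * y i)) + ∑∑ (λ i j → Ā i j * (r i * r i * (y i * y j)))
        ≈⟨ +-cong (sum-cong-≋ λ i → solve 2 (λ r y → r :* r :* (y :* y) := r :* y :* (r :* y)) refl (r i) (y i))
                  (sum-zero λ i → sum-zero (Ā-term≈0 i)) ⟩
      sum (λ i → b i * b i) + 0#
        ≈⟨ +-identityʳ _ ⟩
      sum (λ i → b i * b i) ∎)

  motzkin-straus : ∀ {v} → 0# ≤ v → (∀ b → IsClique b → weight b ≤ v) →
    ∀ x → NonNegative x → objective (outer x) ≤ v * ⟨ M , outer x ⟩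
  motzkin-straus {v} 0≤v bound x 0≤x with y′ , y↘y′ , separates ← separate-all {λ i → x i * s i} (λ i → *-nonneg (0≤x i) (0≤s i)) = begin
    objective (outer x)    ≈⟨ objective-outer x ⟩
    sum y * sum y          ≈⟨ *-cong (same-sum y↘y′) (same-sum y↘y′) ⟨
    sum y′ * sum y′
      ≤⟨ separated-bound bound (λ {i} sᵢ≈0 → vanishing y↘y′ {i} (trans (*-congˡ sᵢ≈0) (zeroʳ _))) separates ⟩
    v * form y′            ≤⟨ *-monoˡ-≤ v 0≤v (form-≤ y↘y′) ⟩
    v * form y             ≈⟨ *-congˡ form-y ⟩
    v * ⟨ M , outer x ⟩    ∎
    where
    y : Vector Carrier n
    y i = x i * s i
    form-y : form y ≈ ⟨ M , outer x ⟩
    form-y = begin-equality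
      form y
        ≈⟨ ∑∑-cong (λ i j → trans
             (solve 6 (λ x s r m z t → x :* s :* (r :* r :* m) :* (z :* t) := m :* (s :* r :* r :* t :* (x :* z)))
               refl (x i) (s i) (r i) (I+Ā i j) (x j) (s j))
             (*-congˡ (*-congʳ (*-congʳ (d*r≈r i))))) ⟩
      ∑∑ (λ i j → I+Ā i j * (r i * s j * outer x i j))
        ≈⟨ ⟨M,⟩ (proj₁ (proj₁ (outer-DNN x 0≤x))) ⟨
      ⟨ M , outer x ⟩ ∎

  CP-bound : ∀ {v} → 0# ≤ v → (∀ b → IsClique b → weight b ≤ v) →
    ∀ Z → CompletelyPositive Z → objective Z ≤ v * ⟨ M , Z ⟩
  CP-bound {v} 0≤v bound Z (k , x , 0≤x , Z≈) = begin
    objective Z                              ≈⟨ ⟨,⟩-CP (outer s) Z x Z≈ ⟩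
    ∑[ l < k ] objective (outer (x l))       ≤⟨ sum-mono-≤ (λ l → motzkin-straus 0≤v bound (x l) (0≤x l)) ⟩
    ∑[ l < k ] (v * ⟨ M , outer (x l) ⟩)     ≈⟨ *-distribˡ-sum v (λ l → ⟨ M , outer (x l) ⟩) ⟨
    v * ∑[ l < k ] ⟨ M , outer (x l) ⟩       ≈⟨ *-congˡ (⟨,⟩-CP M Z x Z≈) ⟨
    v * ⟨ M , Z ⟩                            ∎

  open Maximization (definingProgram CompletelyPositive G w) using (Feasible)

  clique-feasible : ∀ b → IsClique b → ¬ weight b ≈ 0# → ∃[ Z ] Feasible Z × objective Z ≈ weight b
  clique-feasible b clique v≉0 =
    outer x , outer-feasible CompletelyPositive ∑x²≈1 x⊙Ā≈0 (outer-CP x 0≤x) , objective≈v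
    where
    v = weight b
    c = √ (v ⁻¹)
    c*c≈v⁻¹ : c * c ≈ v ⁻¹
    c*c≈v⁻¹ = √-square (v ⁻¹) (⁻¹-0≤ (weight-nonneg b))
    v⁻¹*v≈1 : v ⁻¹ * v ≈ 1#
    v⁻¹*v≈1 = trans (*-comm _ _) (⁻¹-inverseʳ v v≉0)

    x : Vector Carrier n
    x i = c * (mask b i * s i)

    0≤x : NonNegative x
    0≤x i = *-nonneg (√-nonneg (v ⁻¹)) (*-nonneg (mask-nonneg b i) (0≤s i))

    ∑x²≈1 : sum (λ i → x i * x i) ≈ 1#
    ∑x²≈1 = begin-equality
      sum (λ i → x i * x i)
        ≈⟨ sum-cong-≋ (λ i → solve 2 (λ c m → c :* m :* (c :* m) := c :* c :* (m :* m)) refl c (mask b i * s i)) ⟩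
      sum (λ i → c * c * ((mask b i * s i) * (mask b i * s i)))
        ≈⟨ *-distribˡ-sum (c * c) (λ i → (mask b i * s i) * (mask b i * s i)) ⟨
      c * c * sum (λ i → (mask b i * s i) * (mask b i * s i))
        ≈⟨ *-cong c*c≈v⁻¹ (∑[mask*s]²≈weight b) ⟩
      v ⁻¹ * v
        ≈⟨ v⁻¹*v≈1 ⟩
      1# ∎

    x≈0 : ∀ {i} → mask b i ≈ 0# → x i ≈ 0#
    x≈0 q = trans (*-congˡ (trans (*-congʳ q) (zeroˡ _))) (zeroʳ _)

    x⊙Ā≈0 : outer x ⊙ Ā ≈ᴹ 𝟎
    x⊙Ā≈0 i j with mask-cases b i | mask-cases b j | adjacency-cases (complement G) i j
    ... | _             | _             | inj₂ (_ , Ā≈0) = trans (*-congˡ Ā≈0) (zeroʳ _)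
    ... | inj₁ (i∈ , _) | inj₁ (j∈ , _) | inj₁ (ij , _)  = contradiction ij (clique i j i∈ j∈)
    ... | inj₂ q        | _             | inj₁ _         = trans (*-congʳ (trans (*-congʳ (x≈0 q)) (zeroˡ _))) (zeroˡ _)
    ... | inj₁ _        | inj₂ q        | inj₁ _         = trans (*-congʳ (trans (*-congˡ (x≈0 q)) (zeroʳ _))) (zeroˡ _)

    ∑x*s≈c*v : sum (λ i → x i * s i) ≈ c * v
    ∑x*s≈c*v = begin-equality
      sum (λ i → x i * s i)
        ≈⟨ sum-cong-≋ (λ i → trans (solve 3 (λ c m s → c :* (m :* s) :* s := c :* (m :* (s :* s))) refl c (mask b i) (s i))
             (*-congˡ (*-congˡ (s*s≈w i)))) ⟩
      sum (λ i → c * (mask b i * w i))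
        ≈⟨ *-distribˡ-sum c (λ i → mask b i * w i) ⟨
      c * v ∎

    objective≈v : objective (outer x) ≈ v
    objective≈v = begin-equality
      objective (outer x)  ≈⟨ objective-outer x ⟩
      sum (λ i → x i * s i) * sum (λ i → x i * s i)  ≈⟨ *-cong ∑x*s≈c*v ∑x*s≈c*v ⟩
      c * v * (c * v)      ≈⟨ solve 2 (λ c v → c :* v :* (c :* v) := c :* c :* v :* v) refl c v ⟩
      c * c * v * v        ≈⟨ *-congʳ (trans (*-congʳ c*c≈v⁻¹) v⁻¹*v≈1) ⟩
      1# * v               ≈⟨ *-identityˡ v ⟩
      v                    ∎

  clique-common-maximum : ∀ {i} → ¬ s i ≈ 0# → ∃[ v ]
    v IsMaximumOf definingProgram CompletelyPositive G w × v IsMaximumOf weightedProgram CompletelyPositive G w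
  clique-common-maximum {i} sᵢ≉0 =
    case maximum IsClique weight (replicate n false , empty-clique) of λ (b , clique , max) →
      let bound = CP-bound (weight-nonneg b) max
          weight≉0 = bounded-at-basis⇒≉0 sᵢ≉0 (bound (outer (basis i)) (outer-CP (basis i) (basis-nonneg i)))
      in weight b , common-maximum CompletelyPositive CP-symmetric CP-nonneg weight≉0
           (clique-feasible b clique weight≉0) bound
    where
    empty-clique : IsClique (replicate n false)
    empty-clique i j i∈ _ = contradiction (≡.trans (≡.sym i∈) (lookup-replicate i false)) λ ()

theorem29 : ExcludedMiddle 0ℓ →
    (ℝ : CompleteOrderedField) →
    let open CompleteOrderedField ℝ using (Carrier)
        open ConicPrograms ℝ in
    (n : ℕ) (G : Graph n) (w : Vector Carrier n) → NonNegative w →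
    (∃[ v ] IsWeightedVectorChromaticNumber G w v × v IsValueOf weightedProgram DoublyNonnegative G w)
    ×
    (∃[ v ] IsWeightedCliqueNumber G w v × v IsValueOf weightedProgram CompletelyPositive G w)
theorem29 em ℝ n G w 0≤w = case Fin.any? (λ i → ¬? (s i ≟ 0#)) of λ where
    (yes (i , sᵢ≉0)) →
      let v , v-max@((Z₀ , feasible , obj≈v) , bound) = DNN-maximum G w
            (outer (basis i) , outer-basis-feasible DoublyNonnegative i (basis-DNN i))
          DNN-bound′ = DNN-bound bound
          v≉0 = bounded-at-basis⇒≉0 sᵢ≉0 (DNN-bound′ (outer (basis i)) (basis-DNN i))
          _ , v-max₂ = common-maximum DoublyNonnegative (proj₁ ∘ proj₁) proj₂ v≉0 (Z₀ , feasible , obj≈v) DNN-bound′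
          u , u-max₁ , u-max₂ = clique-common-maximum sᵢ≉0
      in (v , inj₁ v-max , inj₁ v-max₂) , (u , inj₁ u-max₁ , inj₁ u-max₂)
    (no s≈0) →
      let s≈0′ = λ i → decidable-stable (s i ≟ 0#) λ sᵢ≉0 → s≈0 (i , sᵢ≉0)
      in (0# , zero-common-value DoublyNonnegative (proj₁ ∘ proj₁) proj₂ s≈0′ basis-DNN) ,
         (0# , zero-common-value CompletelyPositive CP-symmetric CP-nonneg s≈0′ (λ i → outer-CP (basis i) (basis-nonneg i)))
  where
  open OrderedSums ℝ
  open MatrixForms ℝ
  open Weighting ℝ G w
  open ClearNonEdges ℝ G w using (DNN-bound)
  open Compactness em ℝ using (DNN-maximum)
  open WeightedCliques em ℝ G w 0≤w using (clique-common-maximum)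

  basis-DNN : ∀ i → DoublyNonnegative (outer (basis i))
  basis-DNN i = outer-DNN (basis i) (basis-nonneg i)
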